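{- (ZF) For every set $S$ with at least two elements, there is no bijection between $\mathrm{Seq}(S)$ and $\mathcal{P}(S)$.
   Context: Work in ZF (Zermelo–Fraenkel set theory without the Axiom of Choice). $\mathcal{P}(S)$ is the power set of $S$ and $\mathrm{Seq}(S)$ is the set of all finite sequences of elements of $S$ without repetition (including the empty sequence). -}

module Defs where

open import Level using (Level; suc)
open import Data.List.Base using (List)
open import Data.List.Relation.Unary.Unique.Propositional using (Unique)
open import Data.Product.Base using (proj₁)
open import Relation.Binary.Bundles using (Setoid)
import Relation.Binary.Construct.On as On
open import Relation.Binary.PropositionalEquality using (setoid)
import Relation.Nullary as Nullary
open import Relation.Nullary using (Dec)
open import Relation.Unary using (Pred; Irrelevant)
open import Relation.Unary.Relation.Binary.Equality using (≐-setoid)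

private
  variable
    a : Level

-- The classical logic of ZF.  It is restricted to propositions because
-- Axiom.ExcludedMiddle, which decides arbitrary types, picks an element of
-- every nonempty type and so yields the axiom of choice.
PropExcludedMiddle : ∀ a → Set (suc a)
PropExcludedMiddle a = {P : Set a} → Nullary.Irrelevant P → Dec P

-- Sequences are compared by their entries only, not by the evidence that
-- there are no repetitions.
Seq : Set a → Setoid a a
Seq S = On.setoid (setoid (List S)) (proj₁ {B = Unique})

-- A subset is a proposition-valued predicate; subsets with the same elements
-- are equal.  Without Irrelevant, a predicate would be a family of types
-- over S, and ≐ would distinguish families with the same support.
𝒫 : Set a → Setoid (suc a) a
𝒫 {a} S = On.setoid (≐-setoid S a) (proj₁ {B = λ (P : Pred S a) → Irrelevant P})

{-# OPTIONS --safe #-}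
module Submission where

-- Let F : Seq S → 𝒫 S be a bijection, with inverse g, and let a n be the
-- number of sequences without repetition over n elements.
--
-- S is Dedekind finite.  Otherwise extend a countable A ⊆ S transfinitely,
-- carrying along an injection h of the finite sequences over A into A.  The
-- subset {h t : h t ∉ F t} is not F t for any t over A, so it provides an
-- element outside A.  Doing this |A| times doubles A; finite sequences over
-- two copies of A are coded by sequences over A, so h extends coherently.
-- A maximal such A cannot exist, yet Zermelo's theorem provides one.
--
-- Consequently every countable family of subsets of S is finite, because the
-- sequences coding its members have only finitely many entries altogether.
-- Call E ⊆ S closed if every subset of S that is definable from the elements
-- of E and the F t with t over E is itself of that form F t.  A finite closed
-- E with n elements satisfies a n = 2 ^ k, where k is the number of classes
-- of points of S indistinguishable over E.  By Dedekind finiteness there is a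
-- finite E that is closed, contains every finite A with g A over E, and such
-- that indistinguishable points over E have isomorphic closures over E.
--
-- If E = S, then a n = 2 ^ k with k ≤ n, so n ≤ 1.  Otherwise let V be a
-- minimal closed set strictly between E and S, with m elements.  Since a n and
-- a m are powers of two, 2 ^ k divides m − n; as k < 2 ^ k, two elements y ≠ z
-- of V ∖ E are indistinguishable over E.  The isomorphism of their closures is
-- an automorphism of V that moves y.  Its fixed points are closed and contain
-- E, so they are exactly E.  Being invariant, V is F t with t fixed, that is,
-- with t over E; thus V ⊆ E, a contradiction.

open import Defs
open import Axiom.Extensionality.Propositional using (Extensionality; lower-extensionality)
open import Axiom.UniquenessOfIdentityProofs.WithK using (uip)
open import Data.Bool.Base using (Bool; true; false)
import Data.Bool.Properties as Bool
open import Data.Empty using (⊥; ⊥-elim)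
open import Data.Fin.Base as Fin using (Fin; zero; suc; toℕ; remQuot; combine; punchIn; punchOut; finToFun; funToFin)
open import Data.Fin.Properties using (combine-remQuot; remQuot-combine; punchIn-injective; punchInᵢ≢i; punchIn-punchOut)
import Data.Fin.Properties as Fin
open import Data.List.Base using (List; []; _∷_; map; lookup; tabulate; length; filter; deduplicate; _++_)
open import Data.List.Properties using (map-injective; ∷-injective; tabulate-cong; length-++; filter-notAll)
import Data.List.Membership.DecPropositional as DecMembership
open import Data.List.Membership.Propositional using (_∈_)
open import Data.List.Membership.Propositional.Properties using (∈-lookup; ∈-tabulate⁺; ∈-filter⁺; ∈-filter⁻; ∈-deduplicate⁺; ∈-deduplicate⁻; ∈-++⁺ˡ; ∈-++⁺ʳ; ∈-map⁺; ∈-map⁻)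
open import Data.List.Relation.Binary.Pointwise.Base using (Pointwise; []; _∷_)
open import Data.List.Relation.Unary.All as All using (All; []; _∷_)
import Data.List.Relation.Unary.All.Properties as All
open import Data.List.Relation.Unary.AllPairs using ([]; _∷_)
open import Data.List.Relation.Unary.Any as Any using (here; there; index)
open import Data.List.Relation.Unary.Any.Properties using (lookup-index)
open import Data.List.Relation.Unary.Unique.DecPropositional using (unique?)
import Data.List.Relation.Unary.Unique.DecPropositional.Properties as UniqueDec
open import Data.List.Relation.Unary.Unique.Propositional using (Unique)
import Data.List.Relation.Unary.Unique.Propositional.Properties as Unique
open import Data.Nat.Base using (ℕ; zero; suc; _+_; _*_; _^_; _≤_; _<_; z≤n; s≤s; >-nonZero; _≤′_; ≤′-refl; ≤′-step)
open import Data.Nat.Divisibility using (_∣_; divides; 1∣_; ∣⇒≤; ∣-refl; ∣-trans; m∣m*n; ∣m+n∣m⇒∣n; *-monoʳ-∣; *-cancelˡ-∣)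
open import Data.Nat.Induction using (<-rec)
open import Data.Nat.Primality using (prime?; euclidsLemma)
open import Data.Nat.Properties using (<-cmp; suc-injective; +-suc; +-comm; *-comm; *-assoc; *-cancelˡ-≡; ≤-trans; ≤-refl; <⇒≤; <⇒≱; <⇒≢; ≮⇒≥; <-irrefl; n≢0⇒n>0; m≤m+n; +-mono-≤; +-monoʳ-≤; *-monoʳ-≤; *-monoˡ-≤; ^-monoʳ-<)
import Data.Nat.Properties as ℕ
open import Data.Nat.Tactic.RingSolver using (solve-∀)
open import Data.Product.Base using (Σ; ∃₂; _×_; _,_; proj₁; proj₂; uncurry)
open import Data.Sum.Base using (_⊎_; inj₁; inj₂; [_,_]′)
open import Function.Base using (_∘_; id; const)
open import Function.Bundles using (Bijection)
open import Level using (Level; Lift; lift; lower)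
import Relation.Nullary as Nullary
open import Relation.Nullary using (¬_; Dec; yes; no; contradiction)
open import Relation.Nullary.Decidable using (decidable-stable; from-yes; ¬?)
open import Relation.Binary.Definitions using (DecidableEquality; tri<; tri≈; tri>)
open import Relation.Binary.PropositionalEquality using (_≡_; _≢_; refl; sym; trans; cong; cong₂; subst)

-- Boolean-valued subsets and classical logic.

private
  variable
    a b c : Level

infix 4 _∋_ _⊆_

-- Boolean-valued subsets keep families of subsets, and families of those,
-- in Set a, where the excluded middle applies.
_∋_ : {X : Set a} → (X → Bool) → X → Set
A ∋ x = A x ≡ true

_⊆_ : {X : Set a} → (X → Bool) → (X → Bool) → Set a
A ⊆ B = ∀ x → A ∋ x → B ∋ x

⊆-trans : {X : Set a} {A B C : X → Bool} → A ⊆ B → B ⊆ C → A ⊆ C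
⊆-trans A⊆B B⊆C x = B⊆C x ∘ A⊆B x

∋-stable : ∀ {b} → ¬ ¬ (b ≡ true) → b ≡ true
∋-stable = decidable-stable (_ Bool.≟ true)

∋-iff : ∀ {b c} → (b ≡ true → c ≡ true) → (c ≡ true → b ≡ true) → b ≡ c
∋-iff {true}          f g = sym (f refl)
∋-iff {false} {true}  f g = g refl
∋-iff {false} {false} f g = refl

-- Classical existence is ¬ ¬ Σ throughout: extracting a witness from it is
-- only possible when the witness is unique.
_>>=_ : {A : Set a} {B : Set b} → ¬ ¬ A → (A → ¬ ¬ B) → ¬ ¬ B
(m >>= f) k = m λ x → f x k

return : {A : Set a} → A → ¬ ¬ A
return x k = k x

All-∋-stable : {X : Set a} (A : X → Bool) → ∀ l → ¬ ¬ All (A ∋_) l → All (A ∋_) l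
All-∋-stable A []      _     = []
All-∋-stable A (x ∷ l) ¬¬all =
  ∋-stable (¬¬all >>= (return ∘ All.head)) ∷ All-∋-stable A l (¬¬all >>= (return ∘ All.tail))

module Classical {a} (ext : Extensionality a a) (lem : PropExcludedMiddle a) where

  -- A negation is a proposition, so the restricted excluded middle decides it for every type `P`;
  -- the positive case survives only doubly negated.
  em : (P : Set a) → ¬ P ⊎ ¬ ¬ P
  em P with lem {¬ P} (λ _ _ → refl)
  ... | yes ¬p = inj₁ ¬p
  ... | no ¬¬p = inj₂ ¬¬p

  decide : {A : Set b} (P : Set a) → (P → ¬ ¬ A) → (¬ P → ¬ ¬ A) → ¬ ¬ A
  decide P f g with em P
  ... | inj₁ ¬p = g ¬p
  ... | inj₂ ¬¬p = ¬¬p >>= f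

  prop-stable : {P : Set a} → Nullary.Irrelevant P → ¬ ¬ P → P
  prop-stable irr = decidable-stable (lem irr)

  ≡-stable : {X : Set a} {x y : X} → ¬ ¬ (x ≡ y) → x ≡ y
  ≡-stable = prop-stable uip

  abstract
    ⟦_⟧ : Set a → Bool
    ⟦ P ⟧ = [ const false , const true ]′ (em P)

    ⟦⟧-intro : {P : Set a} → P → ⟦ P ⟧ ≡ true
    ⟦⟧-intro {P} p with em P
    ... | inj₁ ¬p = contradiction p ¬p
    ... | inj₂ _ = refl

    ⟦⟧-elim : {P : Set a} → ⟦ P ⟧ ≡ true → ¬ ¬ P
    ⟦⟧-elim {P} eq with em P
    ⟦⟧-elim () | inj₁ _
    ⟦⟧-elim _  | inj₂ ¬¬p = ¬¬p

  ⊆-antisym : {X : Set a} {A B : X → Bool} → A ⊆ B → B ⊆ A → A ≡ B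
  ⊆-antisym A⊆B B⊆A = lower-extensionality a a ext λ x → ∋-iff (A⊆B x) (B⊆A x)

  ⊆-stable : {X : Set a} {A B : X → Bool} → ¬ ¬ (A ⊆ B) → A ⊆ B
  ⊆-stable ¬¬⊆ x Ax = ∋-stable (¬¬⊆ >>= λ ⊆ → return (⊆ x Ax))

  -- Zermelo's proof of the Bourbaki–Witt theorem: the least family of subsets
  -- of U that contains base and is closed under step and under nonempty
  -- unions is a chain.
  module Tower {U : Set a} (base : U → Bool) (step : (U → Bool) → (U → Bool))
               (inflationary : ∀ x → x ⊆ step x) where

    ⋃ : ((U → Bool) → Bool) → (U → Bool)
    ⋃ C u = ⟦ Σ (U → Bool) (λ x → C ∋ x × x ∋ u) ⟧

    ⊆-⋃ : ∀ {C x} → C ∋ x → x ⊆ ⋃ C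
    ⊆-⋃ Cx u xu = ⟦⟧-intro (_ , Cx , xu)

    ⋃-⊆ : ∀ {C y} → (∀ x → C ∋ x → x ⊆ y) → ⋃ C ⊆ y
    ⋃-⊆ C⊆y u ⋃u = ∋-stable (⟦⟧-elim ⋃u >>= λ (x , Cx , xu) → return (C⊆y x Cx u xu))

    Inhabited : ((U → Bool) → Bool) → Set a
    Inhabited C = ¬ ¬ (Σ (U → Bool) (C ∋_))

    Closed : ((U → Bool) → Bool) → Set a
    Closed 𝒯 = 𝒯 ∋ base × (∀ x → 𝒯 ∋ x → 𝒯 ∋ step x) ×
      (∀ C → (∀ x → C ∋ x → 𝒯 ∋ x) → Inhabited C → 𝒯 ∋ ⋃ C)

    -- An impredicative intersection: Boolean-valued families keep the quantifier in `Set a`, so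
    -- `⟦ T x ⟧` is again such a family.
    T : (U → Bool) → Set a
    T x = ∀ 𝒯 → Closed 𝒯 → 𝒯 ∋ x

    T-stable : ∀ {x} → ¬ ¬ T x → T x
    T-stable ¬¬Tx 𝒯 cl = ∋-stable (¬¬Tx >>= λ Tx → return (Tx 𝒯 cl))

    T-base : T base
    T-base 𝒯 (b , _) = b

    T-step : ∀ {x} → T x → T (step x)
    T-step Tx 𝒯 cl@(_ , s , _) = s _ (Tx 𝒯 cl)

    T-⋃ : ∀ C → (∀ x → C ∋ x → T x) → Inhabited C → T (⋃ C)
    T-⋃ C C⊆T inh 𝒯 cl@(_ , _ , u) = u C (λ x Cx → C⊆T x Cx 𝒯 cl) inh

    induction : (P : (U → Bool) → Set a) → P base →
      (∀ x → T x → P x → ¬ ¬ P (step x)) →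
      (∀ C → (∀ x → C ∋ x → T x) → (∀ x → C ∋ x → ¬ ¬ P x) → Inhabited C → ¬ ¬ P (⋃ C)) →
      ∀ x → T x → ¬ ¬ P x
    induction P Pbase Pstep P⋃ x Tx =
      ⟦⟧-elim (Tx (λ y → ⟦ T y × P y ⟧)
        ( ⟦⟧-intro (T-base , Pbase)
        , (λ y ⟦y⟧ → ∋-stable do
             Ty , Py ← ⟦⟧-elim ⟦y⟧
             Psy ← Pstep y Ty Py
             return (⟦⟧-intro (T-step Ty , Psy)))
        , λ C C⊆ inh →
             let C⊆T = λ y Cy → T-stable (⟦⟧-elim (C⊆ y Cy) >>= (return ∘ proj₁)) in
             ∋-stable do
               P⋃C ← P⋃ C C⊆T (λ y Cy → ⟦⟧-elim (C⊆ y Cy) >>= (return ∘ proj₂)) inh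
               return (⟦⟧-intro (T-⋃ C C⊆T inh , P⋃C))))
      >>= (return ∘ proj₂)

    base-least : ∀ x → T x → base ⊆ x
    base-least x Tx = ⊆-stable (induction (base ⊆_) (λ _ → id)
      (λ y _ b⊆y → return (⊆-trans b⊆y (inflationary y)))
      (λ C _ b⊆ inh → inh >>= λ (y , Cy) → b⊆ y Cy >>= λ b⊆y → return (⊆-trans b⊆y (⊆-⋃ Cy)))
      x Tx)

    -- The extreme points of the usual proof of Bourbaki-Witt, with strict inclusion expressed by
    -- `¬ (x ⊆ y)`.
    Extreme : (U → Bool) → Set a
    Extreme x = ∀ y → T y → y ⊆ x → ¬ (x ⊆ y) → step y ⊆ x

    extreme-comparable : ∀ x → T x → Extreme x → ∀ y → T y → ¬ ¬ (y ⊆ x ⊎ step x ⊆ y)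
    extreme-comparable x Tx ex = induction (λ y → y ⊆ x ⊎ step x ⊆ y)
      (inj₁ (base-least x Tx))
      (λ { y Ty (inj₁ y⊆x) → decide (x ⊆ y)
             (λ x⊆y → return (inj₂ (subst (λ z → step z ⊆ step y) (⊆-antisym y⊆x x⊆y) (λ _ → id))))
             (λ x⊈y → return (inj₁ (ex y Ty y⊆x x⊈y)))
         ; y Ty (inj₂ sx⊆y) → return (inj₂ (⊆-trans sx⊆y (inflationary y))) })
      (λ C C⊆T ih inh → decide (Σ (U → Bool) λ y → C ∋ y × step x ⊆ y)
        (λ (y , Cy , sx⊆y) → return (inj₂ (⊆-trans sx⊆y (⊆-⋃ Cy))))
        (λ none → return (inj₁ (⋃-⊆ λ y Cy → ⊆-stable (ih y Cy >>= λ
          { (inj₁ y⊆x) → return y⊆x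
          ; (inj₂ sx⊆y) → contradiction (y , Cy , sx⊆y) none })))))

    extreme : ∀ x → T x → Extreme x
    extreme x Tx y Ty y⊆x x⊈y = ⊆-stable (induction Extreme
      (λ y Ty _ b⊈y → contradiction (base-least y Ty) b⊈y)
      (λ x Tx ex → return λ y Ty y⊆sx sx⊈y → ⊆-stable (extreme-comparable x Tx ex y Ty >>= λ
        { (inj₁ y⊆x) → decide (x ⊆ y)
            (λ x⊆y → return (subst (λ z → step y ⊆ step z) (⊆-antisym y⊆x x⊆y) (λ _ → id)))
            (λ x⊈y → return (⊆-trans (ex y Ty y⊆x x⊈y) (inflationary x)))
        ; (inj₂ sx⊆y) → contradiction sx⊆y sx⊈y }))
      -- As `y` does not contain the union, some `z` in `C` is not inside `y`. Comparability at `z`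
      -- leaves only `y ⊆ z`, and extremality of `z` gives `step y ⊆ z`.
      (λ C C⊆T ih _ → return λ y Ty y⊆⋃ ⋃⊈y → ⊆-stable λ k → ⋃⊈y (⋃-⊆ λ z Cz →
        ⊆-stable λ z⊈y → (ih z Cz >>= λ ez → extreme-comparable z (C⊆T z Cz) ez y Ty >>= λ
          { (inj₁ y⊆z) → return (⊆-trans (ez y Ty y⊆z z⊈y) (⊆-⋃ Cz))
          ; (inj₂ sz⊆y) → contradiction (⊆-trans (inflationary z) sz⊆y) z⊈y }) k))
      x Tx >>= λ ex → return (ex y Ty y⊆x x⊈y))

    chain : ∀ {x y} → T x → T y → ¬ ¬ (x ⊆ y ⊎ y ⊆ x)
    chain {x} {y} Tx Ty = extreme-comparable x Tx (extreme x Tx) y Ty >>= λ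
      { (inj₁ y⊆x) → return (inj₂ y⊆x)
      ; (inj₂ sx⊆y) → return (inj₁ (⊆-trans (inflationary x) sx⊆y)) }

    -- This carries invariants with two premises, such as functionality of a graph, through unions.
    common : ∀ {C u u′} → (∀ x → C ∋ x → T x) → ⋃ C ∋ u → ⋃ C ∋ u′ →
             ¬ ¬ (Σ (U → Bool) λ x → C ∋ x × x ∋ u × x ∋ u′)
    common C⊆T p q = do
      x , Cx , xu ← ⟦⟧-elim p
      y , Cy , yu ← ⟦⟧-elim q
      inj₁ x⊆y ← chain (C⊆T x Cx) (C⊆T y Cy)
        where inj₂ y⊆x → return (x , Cx , xu , y⊆x _ yu)
      return (y , Cy , x⊆y _ xu , yu)

    top : U → Bool
    top = ⋃ (⟦_⟧ ∘ T)

    T-top : T top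
    T-top = T-⋃ _ (λ x ⟦Tx⟧ → T-stable (⟦⟧-elim ⟦Tx⟧)) (return (base , ⟦⟧-intro T-base))

    top-fixed : step top ⊆ top
    top-fixed = ⊆-⋃ (⟦⟧-intro (T-step T-top))

-- Injective codes for lists of natural numbers.

double-parity : ∀ m n → suc (m + m) ≢ n + n
double-parity zero    (suc n) eq with () ← trans (suc-injective eq) (+-suc n n)
double-parity (suc m) (suc n) eq rewrite +-suc m m | +-suc n n =
  double-parity m n (suc-injective (suc-injective eq))

double-injective : ∀ m n → m + m ≡ n + n → m ≡ n
double-injective zero    zero    eq = refl
double-injective (suc m) (suc n) eq rewrite +-suc m m | +-suc n n =
  cong suc (double-injective m n (suc-injective (suc-injective eq)))

-- 2 ^ m * (2 * n + 1)
pair : ℕ → ℕ → ℕ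
pair zero    n = suc (n + n)
pair (suc m) n = pair m n + pair m n

pair-injective : ∀ m n m′ n′ → pair m n ≡ pair m′ n′ → m ≡ m′ × n ≡ n′
pair-injective zero    n zero     n′ eq = refl , double-injective n n′ (suc-injective eq)
pair-injective zero    n (suc m′) n′ eq = contradiction eq (double-parity n (pair m′ n′))
pair-injective (suc m) n zero     n′ eq = contradiction (sym eq) (double-parity n′ (pair m n))
pair-injective (suc m) n (suc m′) n′ eq
  with refl , refl ← pair-injective m n m′ n′ (double-injective (pair m n) (pair m′ n′) eq) = refl , refl

abstract
  listCode : List ℕ → ℕ
  listCode []      = 0
  listCode (n ∷ l) = suc (pair n (listCode l))

  listCode-injective : ∀ {l l′} → listCode l ≡ listCode l′ → l ≡ l′
  listCode-injective {[]}    {[]}     eq = refl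
  listCode-injective {n ∷ l} {n′ ∷ l′} eq
    with refl , eq′ ← pair-injective n (listCode l) n′ (listCode l′) (suc-injective eq) =
    cong (n ∷_) (listCode-injective eq′)

Σ-≡ : {X : Set a} {P : X → Set} → (∀ {x} → Nullary.Irrelevant (P x)) →
      {p q : Σ X P} → proj₁ p ≡ proj₁ q → p ≡ q
Σ-≡ irr {x , p} {.x , q} refl = cong (x ,_) (irr p q)

-- Definite description: together with `prop-stable` it extracts the witness of a doubly negated
-- unique existence.
Σ-irrelevant : {X : Set a} {P : X → Set} → (∀ {x} → Nullary.Irrelevant (P x)) →
               (∀ {x y} → P x → P y → x ≡ y) → Nullary.Irrelevant (Σ X P)
Σ-irrelevant irr unique (x , p) (y , q) = Σ-≡ irr (unique p q)

Pointwise-functional : {I : Set a} {S : Set b} {δ : I → S → Set c} →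
  (∀ {i s s′} → δ i s → δ i s′ → s ≡ s′) →
  ∀ {w t t′} → Pointwise δ w t → Pointwise δ w t′ → t ≡ t′
Pointwise-functional fun []       []       = refl
Pointwise-functional fun (p ∷ ps) (q ∷ qs) = cong₂ _∷_ (fun p q) (Pointwise-functional fun ps qs)

unzip-range : {I : Set a} {S : Set b} {δ : I → S → Set c} {l : List S} →
  All (λ s → Σ I λ i → δ i s) l → Σ (List I) λ w → Pointwise δ w l
unzip-range []             = [] , []
unzip-range ((i , p) ∷ ps) = let w , qs = unzip-range ps in i ∷ w , p ∷ qs

-- Diagonalisation against an injection of subsets into lists.

module PowerInjection {a} (ext : Extensionality a a) (lem : PropExcludedMiddle a)
  (S : Set a) (g : (S → Bool) → List S) (g-injective : ∀ {A B} → g A ≡ g B → A ≡ B) (s₀ : S) where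

  open Classical ext lem

  firstOutside : (S → Set a) → List S → S
  -- The default is reached only when no entry is refuted by `R`.
  firstOutside R []      = s₀
  firstOutside R (s ∷ l) = [ const s , const (firstOutside R l) ]′ (em (R s))

  firstOutside-∉ : ∀ {R} l → R (firstOutside R l) → ¬ ¬ All R l
  firstOutside-∉ []      _ = return []
  firstOutside-∉ {R} (s ∷ l) r with em (R s)
  ... | inj₁ ¬Rs  = contradiction r ¬Rs
  ... | inj₂ ¬¬Rs = ¬¬Rs >>= λ Rs → firstOutside-∉ l r >>= λ Rl → return (Rs ∷ Rl)

  module _ {I : Set a} (h : List I → S) (δ : I → S → Set a) where

    -- Cantor's diagonal set, where `w` stands for any `A` whose list `g A` it codes entrywise
    -- through `δ`.
    diagonal : S → Bool
    diagonal s = ⟦ Σ (List I) (λ w → h w ≡ s × (∀ A → Pointwise δ w (g A) → ¬ A ∋ s)) ⟧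

    fresh : S
    fresh = firstOutside (λ s → Σ I λ i → δ i s) (g diagonal)

    -- If `δ` reached `fresh`, it would reach every entry of `g diagonal`. Some `w` would then code
    -- that list, and `h w` would belong to `diagonal` exactly when it does not.
    fresh-∉ : (∀ {w w′} → h w ≡ h w′ → w ≡ w′) → (∀ {i s s′} → δ i s → δ i s′ → s ≡ s′) →
              ∀ {i} → ¬ δ i fresh
    fresh-∉ h-injective δ-functional δif = firstOutside-∉ (g diagonal) (_ , δif) λ all →
      let w , pw = unzip-range all
          ∉D : ¬ diagonal ∋ h w
          ∉D ∈D = ⟦⟧-elim ∈D λ (w′ , eq , avoid) →
            avoid diagonal (subst (λ v → Pointwise δ v (g diagonal)) (sym (h-injective eq)) pw) ∈D
      in ∉D (⟦⟧-intro (w , refl , λ A pw′ A∋ → ∉D (subst (_∋ h w)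
           (g-injective (Pointwise-functional δ-functional pw′ pw)) A∋)))

  Choice : Set a → Set a
  Choice I = (D : I → Bool) → ¬ (∀ i → D ∋ i) → Σ I λ i → ¬ D ∋ i

  -- Transfinite recursion along the well-order that the choice function induces on I.
  module Copy {I : Set a} (choose : Choice I) (j : I → S) (h : List (I ⊎ I) → S)
              (h-injective : ∀ {w w′} → h w ≡ h w′ → w ≡ w′) where

    dom : (I × S → Bool) → I → Bool
    dom x i = ⟦ Σ S (λ s → x ∋ (i , s)) ⟧

    -- `x` is the graph of the partial second copy built so far, beside the given copy `j`; a fresh
    -- element for this `δ` avoids both.
    δ : (I × S → Bool) → I ⊎ I → S → Set a
    δ x (inj₁ i) s = j i ≡ s
    δ x (inj₂ i) s = Lift a (x ∋ (i , s))

    next : ∀ x → ¬ (∀ i → dom x ∋ i) → I × S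
    next x ¬all = proj₁ (choose (dom x) ¬all) , fresh h (δ x)

    step : (I × S → Bool) → (I × S → Bool)
    step x u = ⟦ x ∋ u ⊎ Σ (¬ (∀ i → dom x ∋ i)) (λ ¬all → u ≡ next x ¬all) ⟧

    open Tower (const false) step (λ _ _ xu → ⟦⟧-intro (inj₁ xu))

    record Inv (x : I × S → Bool) : Set a where
      field
        functional : ∀ {i s s′} → x ∋ (i , s) → x ∋ (i , s′) → s ≡ s′
        injective  : ∀ {i i′ s} → x ∋ (i , s) → x ∋ (i′ , s) → i ≡ i′
        avoids     : ∀ {i s i′} → x ∋ (i , s) → j i′ ≢ s

    open Inv

    step-Inv : ∀ x → Inv x → Inv (step x)
    step-Inv x inv = record
      { functional = λ p q → ≡-stable (⟦⟧-elim p >>= λ p → ⟦⟧-elim q >>= λ q → return (fun p q))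
      ; injective = λ p q → ≡-stable (⟦⟧-elim p >>= λ p → ⟦⟧-elim q >>= λ q → return (inje p q))
      ; avoids = λ p eq → ⟦⟧-elim p λ { (inj₁ p) → avoids inv p eq ; (inj₂ (_ , refl)) → new {inj₁ _} eq }
      }
      where
      new : ∀ {i} → ¬ δ x i (fresh h (δ x))
      new = fresh-∉ h (δ x) h-injective λ
        { {inj₁ _} refl refl → refl
        ; {inj₂ _} (lift p) (lift q) → functional inv p q }
      In : I × S → Set a
      In u = x ∋ u ⊎ Σ (¬ (∀ i → dom x ∋ i)) (λ ¬all → u ≡ next x ¬all)
      fun : ∀ {i s s′} → In (i , s) → In (i , s′) → s ≡ s′
      fun (inj₁ p) (inj₁ q) = functional inv p q
      fun (inj₁ p) (inj₂ (¬all , refl)) = contradiction (⟦⟧-intro (_ , p)) (proj₂ (choose (dom x) ¬all))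
      fun (inj₂ (¬all , refl)) (inj₁ p) = contradiction (⟦⟧-intro (_ , p)) (proj₂ (choose (dom x) ¬all))
      fun (inj₂ (_ , refl)) (inj₂ (_ , refl)) = refl
      inje : ∀ {i i′ s} → In (i , s) → In (i′ , s) → i ≡ i′
      inje (inj₁ p) (inj₁ q) = injective inv p q
      inje (inj₁ p) (inj₂ (_ , refl)) = contradiction (lift p) (new {inj₂ _})
      inje (inj₂ (_ , refl)) (inj₁ p) = contradiction (lift p) (new {inj₂ _})
      inje (inj₂ (_ , refl)) (inj₂ (_ , refl)) = refl

    top-Inv : ¬ ¬ Inv top
    top-Inv = induction Inv (record { functional = λ () ; injective = λ () ; avoids = λ () })
      (λ x _ inv → return (step-Inv x inv))
      (λ C C⊆T ih _ → return record
        { functional = λ p q → ≡-stable (common C⊆T p q >>= λ (x , Cx , p , q) →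
            ih x Cx >>= λ inv → return (functional inv p q))
        ; injective = λ p q → ≡-stable (common C⊆T p q >>= λ (x , Cx , p , q) →
            ih x Cx >>= λ inv → return (injective inv p q))
        ; avoids = λ p eq → (⟦⟧-elim p >>= λ (x , Cx , p) → ih x Cx >>= λ inv _ → avoids inv p eq) id
        }) top T-top

    -- An index outside the domain would be chosen and added by `step`, contrary to `top-fixed`.
    total : ¬ ¬ (∀ i → dom top ∋ i)
    total ¬all = proj₂ (choose (dom top) ¬all) (⟦⟧-intro
      (_ , top-fixed _ (⟦⟧-intro (inj₂ (¬all , refl)))))

    graph : ∀ i → Σ S λ s → top ∋ (i , s)
    graph i = prop-stable
      (Σ-irrelevant uip λ p q → ≡-stable (top-Inv >>= λ inv → return (functional inv p q)))
      (total >>= λ all → ⟦⟧-elim (all i))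

    abstract
      copy : I → S
      copy i = proj₁ (graph i)

      copy-injective : ∀ {i i′} → copy i ≡ copy i′ → i ≡ i′
      copy-injective {i} {i′} eq = ≡-stable (top-Inv >>= λ inv → return
        (injective inv (proj₂ (graph i)) (subst (λ s → top ∋ (i′ , s)) (sym eq) (proj₂ (graph i′)))))

      copy-avoids : ∀ {i i′} → j i′ ≢ copy i
      copy-avoids {i} eq = top-Inv λ inv → avoids inv (proj₂ (graph i)) eq

-- Dedekind finiteness by transfinite doubling.

-- A set of atoms describes a stage A of the transfinite construction by the
-- graphs of an injection of the lists over A into A and of a choice function
-- giving an element of A outside D whenever A ⊈ D.  With graphs, the limit
-- stages are plain unions.
data Atom (S : Set a) : Set a where
  mem  : S → Atom S
  code : List S → S → Atom S
  sel  : (S → Bool) → S → Atom S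

module DedekindInfinite {a} (ext : Extensionality a a) (lem : PropExcludedMiddle a)
  (S : Set a) (g : (S → Bool) → List S) (g-injective : ∀ {A B} → g A ≡ g B → A ≡ B)
  (e : ℕ → S) (e-injective : ∀ {m n} → e m ≡ e n → m ≡ n) where

  open Classical ext lem
  open PowerInjection ext lem S g g-injective (e 0)

  mem-all : (Atom S → Bool) → List S → Set a
  mem-all x = All (λ s → x ∋ mem s)

  record Inv (x : Atom S → Bool) : Set a where
    field
      code-dom        : ∀ {t s} → x ∋ code t s → mem-all x t
      code-cod        : ∀ {t s} → x ∋ code t s → x ∋ mem s
      code-total      : ∀ {t} → mem-all x t → ¬ ¬ (Σ S λ s → x ∋ code t s)
      code-functional : ∀ {t s s′} → x ∋ code t s → x ∋ code t s′ → s ≡ s′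
      code-injective  : ∀ {t t′ s} → x ∋ code t s → x ∋ code t′ s → t ≡ t′
      sel-mem         : ∀ {D s} → x ∋ sel D s → x ∋ mem s
      sel-∉           : ∀ {D s} → x ∋ sel D s → ¬ D ∋ s
      sel-total       : ∀ {D s} → x ∋ mem s → ¬ D ∋ s → ¬ ¬ (Σ S λ s′ → x ∋ sel D s′)
      sel-functional  : ∀ {D s s′} → x ∋ sel D s → x ∋ sel D s′ → s ≡ s′
      inhabited       : ¬ ¬ (Σ S λ s → x ∋ mem s)

  open Inv

  Inv-stable : ∀ {x} → ¬ ¬ Inv x → Inv x
  Inv-stable {x} ¬¬inv = record
    { code-dom = λ {t} p → All-∋-stable (x ∘ mem) t (¬¬inv >>= λ inv → return (code-dom inv p))
    ; code-cod = λ p → ∋-stable (¬¬inv >>= λ inv → return (code-cod inv p))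
    ; code-total = λ p → ¬¬inv >>= λ inv → code-total inv p
    ; code-functional = λ p q → ≡-stable (¬¬inv >>= λ inv → return (code-functional inv p q))
    ; code-injective = λ p q → ≡-stable (¬¬inv >>= λ inv → return (code-injective inv p q))
    ; sel-mem = λ p → ∋-stable (¬¬inv >>= λ inv → return (sel-mem inv p))
    ; sel-∉ = λ p q → ¬¬inv λ inv → sel-∉ inv p q
    ; sel-total = λ p q → ¬¬inv >>= λ inv → sel-total inv p q
    ; sel-functional = λ p q → ≡-stable (¬¬inv >>= λ inv → return (sel-functional inv p q))
    ; inhabited = ¬¬inv >>= inhabited
    }

  module Double (x : Atom S → Bool) (inv : Inv x) where

    I : Set a
    I = Σ S λ s → x ∋ mem s

    I-≡ : {i i′ : I} → proj₁ i ≡ proj₁ i′ → i ≡ i′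
    I-≡ = Σ-≡ uip

    members : ∀ (w : List I) → mem-all x (map proj₁ w)
    members []            = []
    members ((_ , p) ∷ w) = p ∷ members w

    encode-graph : ∀ w → Σ S λ s → x ∋ code (map proj₁ w) s
    encode-graph w = prop-stable (Σ-irrelevant uip (code-functional inv)) (code-total inv (members w))

    abstract
      encode : List I → I
      encode w = let s , p = encode-graph w in s , code-cod inv p

      encode-injective : ∀ {w w′} → encode w ≡ encode w′ → w ≡ w′
      encode-injective {w} {w′} eq = map-injective I-≡ (code-injective inv (proj₂ (encode-graph w))
        (subst (λ s → x ∋ code (map proj₁ w′) s) (sym (cong proj₁ eq)) (proj₂ (encode-graph w′))))

    -- Lengths one and two tell the summands apart, so lists over two copies of the stage reduce to
    -- lists over one.
    tag : I ⊎ I → I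
    tag (inj₁ i) = encode (i ∷ [])
    tag (inj₂ i) = encode (i ∷ i ∷ [])

    tag-injective : ∀ {u v} → tag u ≡ tag v → u ≡ v
    tag-injective {inj₁ i} {inj₁ k} eq with refl ← encode-injective {i ∷ []} {k ∷ []} eq = refl
    tag-injective {inj₁ i} {inj₂ k} eq with () ← encode-injective {i ∷ []} {k ∷ k ∷ []} eq
    tag-injective {inj₂ i} {inj₁ k} eq with () ← encode-injective {i ∷ i ∷ []} {k ∷ []} eq
    tag-injective {inj₂ i} {inj₂ k} eq with refl ← encode-injective {i ∷ i ∷ []} {k ∷ k ∷ []} eq = refl

    encode₂ : List (I ⊎ I) → I
    encode₂ = encode ∘ map tag

    encode₂-injective : ∀ {w w′} → encode₂ w ≡ encode₂ w′ → w ≡ w′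
    encode₂-injective = map-injective tag-injective ∘ encode-injective

    abstract
      choose : Choice I
      choose D ¬all = (proj₁ chosen , sel-mem inv (proj₂ chosen)) , λ D∋ →
        sel-∉ inv (proj₂ chosen) (⟦⟧-intro (sel-mem inv (proj₂ chosen) , lift D∋))
        where
        -- `D` is carried along the inclusion of `I`, since `sel` is indexed by subsets of `S`.
        D̂ : S → Bool
        D̂ s = ⟦ Σ (x ∋ mem s) (λ p → Lift a (D ∋ (s , p))) ⟧
        chosen : Σ S λ s → x ∋ sel D̂ s
        chosen = prop-stable (Σ-irrelevant uip (sel-functional inv)) λ none → ¬all λ (s , p) →
          ∋-stable λ ∉D → sel-total inv p
            (λ ∈D̂ → ⟦⟧-elim ∈D̂ λ (q , lift D∋) → ∉D (subst (λ p → D ∋ (s , p)) (uip q p) D∋)) none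

    open Copy choose proj₁ (proj₁ ∘ encode₂) (encode₂-injective ∘ I-≡)
      using (copy; copy-injective; copy-avoids)

    decode : I ⊎ I → S
    decode = [ proj₁ , copy ]′

    decode-injective : ∀ {u v} → decode u ≡ decode v → u ≡ v
    decode-injective {inj₁ _} {inj₁ _} eq = cong inj₁ (I-≡ eq)
    decode-injective {inj₁ i} {inj₂ k} eq = contradiction eq (copy-avoids {k} {i})
    decode-injective {inj₂ k} {inj₁ i} eq = contradiction (sym eq) (copy-avoids {k} {i})
    decode-injective {inj₂ _} {inj₂ _} eq = cong inj₂ (copy-injective eq)

    copy-∉ : ∀ {i} → ¬ x ∋ mem (copy i)
    copy-∉ {i} p = copy-avoids {i} {_ , p} refl

    -- Lists over the old stage keep their codes; the others are coded in the copy, where no old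
    -- code lies. Likewise a choice is added only for a `D` containing the whole old stage. This
    -- keeps both graphs functional and the coding injective.
    New : Atom S → Set a
    New (mem s)    = Σ I λ i → copy i ≡ s
    New (code t s) = Σ (List (I ⊎ I)) λ w → map decode w ≡ t × ¬ mem-all x t × copy (encode₂ w) ≡ s
    New (sel D s)  = ((i : I) → D ∋ proj₁ i) × Σ (¬ (∀ i → D ∋ copy i)) λ ¬all →
                       copy (proj₁ (choose (D ∘ copy) ¬all)) ≡ s

    doubled : Atom S → Bool
    doubled u = ⟦ x ∋ u ⊎ New u ⟧

    old-⊆ : x ⊆ doubled
    old-⊆ u p = ⟦⟧-intro (inj₁ p)

    decode-mem : ∀ u → doubled ∋ mem (decode u)
    decode-mem (inj₁ (_ , p)) = ⟦⟧-intro (inj₁ p)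
    decode-mem (inj₂ i)       = ⟦⟧-intro (inj₂ (i , refl))

    decode-all : ∀ w → mem-all doubled (map decode w)
    decode-all []      = []
    decode-all (u ∷ w) = decode-mem u ∷ decode-all w

    lift-list : ∀ t → mem-all doubled t → ¬ ¬ (Σ (List (I ⊎ I)) λ w → map decode w ≡ t)
    lift-list []      []       = return ([] , refl)
    lift-list (s ∷ t) (p ∷ ps) = do
      w , refl ← lift-list t ps
      inj₁ q ← ⟦⟧-elim p
        where inj₂ (i , refl) → return (inj₂ i ∷ w , refl)
      return (inj₁ (s , q) ∷ w , refl)

    doubled-Inv : Inv doubled
    doubled-Inv = record
      { code-dom = λ {t} p → All-∋-stable (doubled ∘ mem) t (⟦⟧-elim p >>= λ
          { (inj₁ p) → return (All.map (old-⊆ _) (code-dom inv p))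
          ; (inj₂ (w , refl , _)) → return (decode-all w) })
      ; code-cod = λ p → ∋-stable (⟦⟧-elim p >>= λ
          { (inj₁ p) → return (old-⊆ _ (code-cod inv p))
          ; (inj₂ (w , _ , _ , refl)) → return (decode-mem (inj₂ _)) })
      ; code-total = λ {t} all → decide (mem-all x t)
          (λ old → code-total inv old >>= λ (s , p) → return (s , old-⊆ _ p))
          (λ new → lift-list t all >>= λ (w , eq) →
            return (_ , ⟦⟧-intro (inj₂ (w , eq , new , refl))))
      ; code-functional = λ p q → ≡-stable (⟦⟧-elim p >>= λ p → ⟦⟧-elim q >>= λ q → return (cfun p q))
      ; code-injective = λ p q → ≡-stable (⟦⟧-elim p >>= λ p → ⟦⟧-elim q >>= λ q → return (cinj p q))
      ; sel-mem = λ p → ∋-stable (⟦⟧-elim p >>= λ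
          { (inj₁ p) → return (old-⊆ _ (sel-mem inv p))
          ; (inj₂ (_ , _ , refl)) → return (decode-mem (inj₂ _)) })
      ; sel-∉ = λ p q → ⟦⟧-elim p λ
          { (inj₁ p) → sel-∉ inv p q
          ; (inj₂ (_ , ¬all , refl)) → proj₂ (choose _ ¬all) q }
      ; sel-total = λ {D} p s∉D → decide (Σ I λ i → ¬ D ∋ proj₁ i)
          (λ ((_ , q) , ∉D) → sel-total inv q ∉D >>= λ (s , r) → return (s , old-⊆ _ r))
          (λ none → ⟦⟧-elim p >>= λ
            { (inj₁ q) → contradiction ((_ , q) , s∉D) none
            ; (inj₂ (i , refl)) → return (_ , ⟦⟧-intro (inj₂
                ((λ i → ∋-stable λ ∉D → none (i , ∉D)) , (λ all → s∉D (all i)) , refl))) })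
      ; sel-functional = λ p q → ≡-stable (⟦⟧-elim p >>= λ p → ⟦⟧-elim q >>= λ q → return (sfun p q))
      ; inhabited = inhabited inv >>= λ (s , p) → return (s , old-⊆ _ p)
      }
      where
      In : Atom S → Set a
      In u = x ∋ u ⊎ New u
      cfun : ∀ {t s s′} → In (code t s) → In (code t s′) → s ≡ s′
      cfun (inj₁ p) (inj₁ q) = code-functional inv p q
      cfun (inj₁ p) (inj₂ (_ , _ , new , _)) = contradiction (code-dom inv p) new
      cfun (inj₂ (_ , _ , new , _)) (inj₁ q) = contradiction (code-dom inv q) new
      cfun (inj₂ (_ , eq , _ , refl)) (inj₂ (_ , eq′ , _ , refl)) =
        cong (copy ∘ encode₂) (map-injective decode-injective (trans eq (sym eq′)))
      cinj : ∀ {t t′ s} → In (code t s) → In (code t′ s) → t ≡ t′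
      cinj (inj₁ p) (inj₁ q) = code-injective inv p q
      cinj (inj₁ p) (inj₂ (_ , _ , _ , refl)) = contradiction (code-cod inv p) copy-∉
      cinj (inj₂ (_ , _ , _ , refl)) (inj₁ q) = contradiction (code-cod inv q) copy-∉
      cinj (inj₂ (_ , refl , _ , eq)) (inj₂ (_ , refl , _ , eq′)) =
        cong (map decode) (encode₂-injective (copy-injective (trans eq (sym eq′))))
      sfun : ∀ {D s s′} → In (sel D s) → In (sel D s′) → s ≡ s′
      sfun (inj₁ p) (inj₁ q) = sel-functional inv p q
      sfun (inj₁ p) (inj₂ (all , _)) = contradiction (all (_ , sel-mem inv p)) (sel-∉ inv p)
      sfun (inj₂ (all , _)) (inj₁ q) = contradiction (all (_ , sel-mem inv q)) (sel-∉ inv q)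
      sfun (inj₂ (_ , _ , eq)) (inj₂ (_ , _ , eq′)) = trans (sym eq) eq′

    growing : ¬ (doubled ⊆ x)
    growing ⊆x = inhabited inv λ (_ , p) → copy-∉ (⊆x _ (decode-mem (inj₂ (_ , p))))

  -- `Tower` asks for a step on every set of atoms while doubling presupposes `Inv`; elsewhere the
  -- step is the identity.
  step : (Atom S → Bool) → (Atom S → Bool)
  step x = [ const x , (λ ¬¬inv → Double.doubled x (Inv-stable ¬¬inv)) ]′ (em (Inv x))

  step-⊇ : ∀ x → x ⊆ step x
  step-⊇ x with em (Inv x)
  ... | inj₁ _     = λ _ → id
  ... | inj₂ ¬¬inv = Double.old-⊆ x (Inv-stable ¬¬inv)

  step-Inv : ∀ x → Inv x → Inv (step x)
  step-Inv x inv with em (Inv x)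
  ... | inj₁ ¬inv  = contradiction inv ¬inv
  ... | inj₂ ¬¬inv = Double.doubled-Inv x (Inv-stable ¬¬inv)

  step-growing : ∀ x → Inv x → ¬ (step x ⊆ x)
  step-growing x inv with em (Inv x)
  ... | inj₁ ¬inv  = contradiction inv ¬inv
  ... | inj₂ ¬¬inv = Double.growing x (Inv-stable ¬¬inv)

  Base : Atom S → Set a
  Base (mem s)    = Σ ℕ λ n → e n ≡ s
  Base (code t s) = Σ (List ℕ) λ l → map e l ≡ t × e (listCode l) ≡ s
  Base (sel D s)  = Σ ℕ λ n → e n ≡ s × ¬ D ∋ e n × (∀ {m} → m < n → D ∋ e m)

  base : Atom S → Bool
  base u = ⟦ Base u ⟧

  base-Inv : Inv base
  base-Inv = record
    { code-dom = λ {t} p → All-∋-stable (base ∘ mem) t (⟦⟧-elim p >>= λ { (l , refl , _) → return (all l) })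
    ; code-cod = λ p → ∋-stable (⟦⟧-elim p >>= λ (l , _ , eq) → return (⟦⟧-intro (_ , eq)))
    ; code-total = λ {t} all → lift-list t all >>= λ (l , eq) → return (_ , ⟦⟧-intro (l , eq , refl))
    ; code-functional = λ p q → ≡-stable (⟦⟧-elim p >>= λ { (l , eq , refl) →
        ⟦⟧-elim q >>= λ { (l′ , eq′ , refl) →
        return (cong (e ∘ listCode) (map-injective e-injective (trans eq (sym eq′)))) } })
    ; code-injective = λ p q → ≡-stable (⟦⟧-elim p >>= λ { (l , refl , eq) →
        ⟦⟧-elim q >>= λ { (l′ , refl , eq′) →
        return (cong (map e) (listCode-injective (e-injective (trans eq (sym eq′))))) } })
    ; sel-mem = λ p → ∋-stable (⟦⟧-elim p >>= λ (n , eq , _) → return (⟦⟧-intro (n , eq)))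
    ; sel-∉ = λ p q → ⟦⟧-elim p λ { (n , refl , ∉D , _) → ∉D q }
    ; sel-total = λ {D} p ∉D → ⟦⟧-elim p >>= λ { (n , refl) → least D n ∉D }
    ; sel-functional = λ {D} p q → ≡-stable (⟦⟧-elim p >>= λ { (m , refl , m∉ , <m) →
        ⟦⟧-elim q >>= λ { (n , refl , n∉ , <n) → return (cong e (unique {D} m∉ <m n∉ <n)) } })
    ; inhabited = return (e 0 , ⟦⟧-intro (0 , refl))
    }
    where
    all : ∀ l → mem-all base (map e l)
    all []      = []
    all (n ∷ l) = ⟦⟧-intro (n , refl) ∷ all l
    lift-list : ∀ t → mem-all base t → ¬ ¬ (Σ (List ℕ) λ l → map e l ≡ t)
    lift-list []      []       = return ([] , refl)
    lift-list (s ∷ t) (p ∷ ps) = do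
      n , refl ← ⟦⟧-elim p
      l , refl ← lift-list t ps
      return (n ∷ l , refl)
    least : ∀ D n → ¬ D ∋ e n → ¬ ¬ (Σ S λ s → base ∋ sel D s)
    least D = <-rec _ λ n rec ∉D none → none (e n , ⟦⟧-intro (n , refl , ∉D ,
      λ m<n → ∋-stable λ m∉ → rec m<n m∉ none))
    unique : ∀ {D : S → Bool} {m n} → ¬ D ∋ e m → (∀ {k} → k < m → D ∋ e k) →
             ¬ D ∋ e n → (∀ {k} → k < n → D ∋ e k) → m ≡ n
    unique {m = m} {n} m∉ <m n∉ <n with <-cmp m n
    ... | tri< m<n _ _ = contradiction (<n m<n) m∉
    ... | tri≈ _ m≡n _ = m≡n
    ... | tri> _ _ n<m = contradiction (<m n<m) n∉

  open Tower base step step-⊇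

  -- Finitely many members of a chain have a largest one; `Inhabited` provides a member for the
  -- empty list.
  common-all : ∀ {C t} → (∀ x → C ∋ x → T x) → Inhabited C → mem-all (⋃ C) t →
               ¬ ¬ (Σ (Atom S → Bool) λ x → C ∋ x × mem-all x t)
  common-all C⊆T inh []       = inh >>= λ (x , Cx) → return (x , Cx , [])
  common-all C⊆T inh (p ∷ ps) = do
    x , Cx , xp ← ⟦⟧-elim p
    y , Cy , yps ← common-all C⊆T inh ps
    inj₁ x⊆y ← chain (C⊆T x Cx) (C⊆T y Cy)
      where inj₂ y⊆x → return (x , Cx , xp ∷ All.map (y⊆x _) yps)
    return (y , Cy , x⊆y _ xp ∷ yps)

  ⋃-Inv : ∀ C → (∀ x → C ∋ x → T x) → (∀ x → C ∋ x → Inv x) → Inhabited C → Inv (⋃ C)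
  ⋃-Inv C C⊆T invs inh = record
    { code-dom = λ {t} p → All-∋-stable (⋃ C ∘ mem) t (⟦⟧-elim p >>= λ (x , Cx , p) →
        return (All.map (⊆-⋃ Cx _) (code-dom (invs x Cx) p)))
    ; code-cod = λ p → ∋-stable (⟦⟧-elim p >>= λ (x , Cx , p) →
        return (⊆-⋃ Cx _ (code-cod (invs x Cx) p)))
    ; code-total = λ all → common-all C⊆T inh all >>= λ (x , Cx , all) →
        code-total (invs x Cx) all >>= λ (s , p) → return (s , ⊆-⋃ Cx _ p)
    ; code-functional = λ p q → ≡-stable (common C⊆T p q >>= λ (x , Cx , p , q) →
        return (code-functional (invs x Cx) p q))
    ; code-injective = λ p q → ≡-stable (common C⊆T p q >>= λ (x , Cx , p , q) →
        return (code-injective (invs x Cx) p q))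
    ; sel-mem = λ p → ∋-stable (⟦⟧-elim p >>= λ (x , Cx , p) →
        return (⊆-⋃ Cx _ (sel-mem (invs x Cx) p)))
    ; sel-∉ = λ p q → ⟦⟧-elim p λ (x , Cx , p) → sel-∉ (invs x Cx) p q
    ; sel-total = λ p ∉D → ⟦⟧-elim p >>= λ (x , Cx , p) →
        sel-total (invs x Cx) p ∉D >>= λ (s , q) → return (s , ⊆-⋃ Cx _ q)
    ; sel-functional = λ p q → ≡-stable (common C⊆T p q >>= λ (x , Cx , p , q) →
        return (sel-functional (invs x Cx) p q))
    ; inhabited = inh >>= λ (x , Cx) → inhabited (invs x Cx) >>= λ (s , p) → return (s , ⊆-⋃ Cx _ p)
    }

  top-Inv : Inv top
  top-Inv = Inv-stable (induction Inv base-Inv (λ x _ inv → return (step-Inv x inv))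
    (λ C C⊆T ih inh → return (⋃-Inv C C⊆T (λ x Cx → Inv-stable (ih x Cx)) inh)) top T-top)

  absurd : ⊥
  absurd = step-growing top top-Inv top-fixed

-- Counting sequences without repetition.

lookup-injective : {A : Set a} {l : List A} → Unique l → ∀ {i j} → lookup l i ≡ lookup l j → i ≡ j
lookup-injective (x∉ ∷ u) {zero}  {zero}  eq = refl
lookup-injective (x∉ ∷ u) {zero}  {suc j} eq = contradiction eq (All.lookup x∉ (∈-lookup j))
lookup-injective (x∉ ∷ u) {suc i} {zero}  eq = contradiction (sym eq) (All.lookup x∉ (∈-lookup i))
lookup-injective (x∉ ∷ u) {suc i} {suc j} eq = cong suc (lookup-injective u eq)

tabulate-injective : {A : Set a} {n : ℕ} {f g : Fin n → A} → tabulate f ≡ tabulate g → ∀ i → f i ≡ g i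
tabulate-injective eq zero    = proj₁ (∷-injective eq)
tabulate-injective eq (suc i) = tabulate-injective (proj₂ (∷-injective eq)) i

-- The number of sequences without repetition over `n` elements: a nonempty one is a head followed
-- by a sequence over the remaining elements.
arrangements : ℕ → ℕ
arrangements zero    = 1
arrangements (suc n) = suc (suc n * arrangements n)

unrank : ∀ n → Fin (arrangements n) → List (Fin n)
unrank zero    _       = []
unrank (suc n) zero    = []
unrank (suc n) (suc r) =
  let i , r′ = remQuot {suc n} (arrangements n) r in i ∷ map (punchIn i) (unrank n r′)

unrank-unique : ∀ n r → Unique (unrank n r)
unrank-unique zero    _       = []
unrank-unique (suc n) zero    = []
unrank-unique (suc n) (suc r) =
  let i , r′ = remQuot {suc n} (arrangements n) r in
  All.map⁺ (All.universal (λ j eq → punchInᵢ≢i i j (sym eq)) (unrank n r′)) ∷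
  Unique.map⁺ (punchIn-injective i _ _) (unrank-unique n r′)

unrank-injective : ∀ n {r s} → unrank n r ≡ unrank n s → r ≡ s
unrank-injective zero    {zero}  {zero}  eq = refl
unrank-injective (suc n) {zero}  {zero}  eq = refl
unrank-injective (suc n) {suc r} {suc s} eq = cong suc (remQuot-injective
  (cong₂ _,_ (proj₁ (∷-injective eq)) (unrank-injective n (map-injective (punchIn-injective _ _ _)
    (trans (proj₂ (∷-injective eq)) (cong (λ i → map (punchIn i) _) (sym (proj₁ (∷-injective eq)))))))))
  where
  remQuot-injective : ∀ {r s} → remQuot {suc n} (arrangements n) r ≡ remQuot (arrangements n) s → r ≡ s
  remQuot-injective {r} {s} eq = trans (sym (combine-remQuot {suc n} (arrangements n) r))
    (trans (cong (uncurry combine) eq) (combine-remQuot {suc n} (arrangements n) s))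

punchOut-all : ∀ {n} {i : Fin (suc n)} {l} → All (i ≢_) l → Σ (List (Fin n)) λ l′ → map (punchIn i) l′ ≡ l
punchOut-all []        = [] , refl
punchOut-all (i≢j ∷ p) =
  let l′ , eq = punchOut-all p in punchOut i≢j ∷ l′ , cong₂ _∷_ (punchIn-punchOut i≢j) eq

unrank-surjective : ∀ n {l} → Unique l → Σ (Fin (arrangements n)) λ r → unrank n r ≡ l
unrank-surjective zero    {[]}    _  = zero , refl
unrank-surjective (suc n) {[]}    _  = zero , refl
unrank-surjective (suc n) {i ∷ _} (i∉ ∷ u) with l′ , refl ← punchOut-all i∉
  with r , refl ← unrank-surjective n {l′} (Unique.map⁻ u) =
  suc (combine i r) , cong (λ (j , s) → j ∷ map (punchIn j) (unrank n s)) (remQuot-combine i r)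

-- Powers of two among the numbers of arrangements.

halfArr : ℕ → ℕ
halfArr zero    = 1
halfArr (suc r) = 2 * suc r * (3 + 2 * r) * halfArr r + (2 + r)

-- The recurrence of `halfArr` is that of `arrangements` unfolded twice and halved.
arrangements-odd : ∀ r → arrangements (suc (2 * r)) ≡ 2 * halfArr r
arrangements-odd zero    = refl
arrangements-odd (suc r) = trans
  (cong (λ m → suc (suc m * arrangements m)) (double-suc r))
  (trans (cong (λ m → suc ((3 + 2 * r) * suc ((2 + 2 * r) * m))) (arrangements-odd r)) (expand r (halfArr r)))
  where
  double-suc : ∀ r → 2 * suc r ≡ suc (suc (2 * r))
  double-suc = solve-∀
  expand : ∀ r h → suc ((3 + 2 * r) * suc ((2 + 2 * r) * (2 * h))) ≡
                   2 * (2 * suc r * (3 + 2 * r) * h + (2 + r))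
  expand = solve-∀

-- The recurrence for halfArr makes this difference t times an odd number
-- already when r = 0, and the oddness persists as r grows.
halfArr-difference : ∀ r t → Σ ℕ λ q → halfArr (r + t) ≡ halfArr r + t * suc (2 * q)
halfArr-difference zero zero = 0 , refl
halfArr-difference zero (suc t) = (3 + 2 * t) * halfArr t , expand t (halfArr t)
  where
  expand : ∀ t h → 2 * suc t * (3 + 2 * t) * h + (2 + t) ≡ 1 + suc t * suc (2 * ((3 + 2 * t) * h))
  expand = solve-∀
halfArr-difference (suc r) t with q , eq ← halfArr-difference r t =
  suc r * (3 + 2 * r) * suc (2 * q) + (5 + 4 * r + 2 * t) * halfArr (r + t) ,
  trans (cong (_+ (2 + (r + t))) (split r t (halfArr (r + t))))
  (trans (cong (λ h → 2 * suc r * (3 + 2 * r) * h + 2 * t * (5 + 4 * r + 2 * t) * halfArr (r + t) + (2 + (r + t))) eq)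
    (expand r t (halfArr r) (halfArr (r + t)) q))
  where
  split : ∀ r t h → 2 * suc (r + t) * (3 + 2 * (r + t)) * h ≡
          2 * suc r * (3 + 2 * r) * h + 2 * t * (5 + 4 * r + 2 * t) * h
  split = solve-∀
  expand : ∀ r t h h′ q → 2 * suc r * (3 + 2 * r) * (h + t * suc (2 * q)) +
             2 * t * (5 + 4 * r + 2 * t) * h′ + (2 + (r + t)) ≡
           2 * suc r * (3 + 2 * r) * h + (2 + r) +
             t * suc (2 * (suc r * (3 + 2 * r) * suc (2 * q) + (5 + 4 * r + 2 * t) * h′))
  expand = solve-∀

odd≢even : ∀ m n → suc (2 * m) ≢ 2 * n
odd≢even m n eq = contradiction (∣m+n∣m⇒∣n (subst (2 ∣_) (trans (sym eq) (sym (+-comm (2 * m) 1))) (m∣m*n n)) (m∣m*n m)) (λ p → <⇒≱ (s≤s (s≤s z≤n)) (∣⇒≤ p))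

parity : ∀ n → Σ ℕ λ r → n ≡ 2 * r ⊎ n ≡ suc (2 * r)
parity zero = 0 , inj₁ refl
parity (suc n) with parity n
... | r , inj₁ refl = r , inj₂ refl
... | r , inj₂ refl = suc r , inj₁ (sym (cong suc (+-suc r (r + 0))))

-- For positive `n`, `arrangements n` is one more than a multiple of `n`, and `arrangements 0` is 1.
-- It is therefore odd at every even `n`.
power-of-two-odd : ∀ n k → arrangements n ≡ 2 ^ suc k → Σ ℕ λ r → n ≡ suc (2 * r) × halfArr r ≡ 2 ^ k
power-of-two-odd n k eq with parity n
... | r , inj₂ refl = r , refl , *-cancelˡ-≡ _ _ 2 (trans (sym (arrangements-odd r)) eq)
... | zero , inj₁ refl = contradiction eq (odd≢even 0 (2 ^ k))
... | suc r , inj₁ refl = contradiction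
  (trans (cong suc (sym (*-assoc 2 (suc r) (arrangements (r + suc (r + 0)))))) eq)
  (odd≢even (suc r * arrangements (r + suc (r + 0))) (2 ^ k))

2^-∣-odd : ∀ k t q → 2 ^ k ∣ t * suc (2 * q) → 2 ^ k ∣ t
2^-∣-odd zero    t q _ = 1∣ t
2^-∣-odd (suc k) t q d with euclidsLemma t (suc (2 * q)) (from-yes (prime? 2)) (∣-trans (m∣m*n (2 ^ k)) d)
... | inj₂ (divides m eq) = contradiction (trans eq (*-comm m 2)) (odd≢even q m)
... | inj₁ (divides m refl) rewrite *-comm m 2 | *-assoc 2 m (suc (2 * q)) =
  *-monoʳ-∣ 2 (2^-∣-odd k m q (*-cancelˡ-∣ 2 d))

-- The difference of the two powers is `t` times an odd number. The smaller power `2 ^ k` divides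
-- it, hence divides `t`.
halfArr-gap : ∀ r t k l → 0 < t → halfArr r ≡ 2 ^ k → halfArr (r + t) ≡ 2 ^ l → 2 ^ k ≤ t
halfArr-gap r t k l t>0 eqr eqt with q , eq ← halfArr-difference r t =
  ∣⇒≤ {{>-nonZero t>0}} (2^-∣-odd k t q (∣m+n∣m⇒∣n (subst (2 ^ k ∣_) sum (m≤n⇒m^n∣ k≤l)) ∣-refl))
  where
  sum : 2 ^ l ≡ 2 ^ k + t * suc (2 * q)
  sum = trans (sym eqt) (trans eq (cong (_+ t * suc (2 * q)) eqr))
  k≤l : k ≤ l
  k≤l = ≮⇒≥ λ l<k → <⇒≱ (^-monoʳ-< 2 (s≤s (s≤s z≤n)) l<k)
          (subst (2 ^ k ≤_) (sym sum) (m≤m+n (2 ^ k) _))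
  m≤n⇒m^n∣ : ∀ {k l} → k ≤ l → 2 ^ k ∣ 2 ^ l
  m≤n⇒m^n∣ {l = l} z≤n = 1∣ (2 ^ l)
  m≤n⇒m^n∣ (s≤s k≤l) = *-monoʳ-∣ 2 (m≤n⇒m^n∣ k≤l)

-- Both arguments are odd, so `d` is some `2 * t`, and halving both values reduces the claim to
-- `halfArr-gap`. The assumption `0 < k` excludes `n = 0`.
arrangements-gap : ∀ n d k l → 0 < d → 0 < k →
  arrangements n ≡ 2 ^ k → arrangements (n + d) ≡ 2 ^ l → 2 ^ k ≤ d
arrangements-gap n d (suc k) zero d>0 _ _ eq with n + d | subst (0 <_) (+-comm d n) (≤-trans d>0 (m≤m+n d n))
... | suc m | _ = contradiction eq λ eq → <⇒≢ (s≤s (positive m)) (sym eq)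
  where
  positive : ∀ m → 0 < suc m * arrangements m
  positive zero    = s≤s z≤n
  positive (suc m) = s≤s z≤n
arrangements-gap n d (suc k) (suc l) d>0 _ eqn eqd
  with r , refl , eqr ← power-of-two-odd n k eqn
  with s , eqs , eqs′ ← power-of-two-odd (n + d) l eqd
  with t , t-eq ← parity d = go t-eq
  where
  go : d ≡ 2 * t ⊎ d ≡ suc (2 * t) → 2 ^ suc k ≤ d
  go (inj₂ refl) = contradiction (trans (sym eqs) (lemma r t)) (odd≢even s (suc (r + t)))
    where
    lemma : ∀ r t → suc (2 * r) + suc (2 * t) ≡ 2 * suc (r + t)
    lemma = solve-∀
  go (inj₁ refl) = *-monoʳ-≤ 2 (halfArr-gap r t k l (n≢0⇒n>0 λ { refl → <-irrefl refl d>0 }) eqr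
    (subst (λ u → halfArr u ≡ 2 ^ l) (*-cancelˡ-≡ s (r + t) 2 (suc-injective (trans (sym eqs) (lemma r t)))) eqs′))
    where
    lemma : ∀ r t → suc (2 * r) + 2 * t ≡ suc (2 * (r + t))
    lemma = solve-∀

arrangements>2^ : ∀ n → 2 ≤ n → 2 ^ n < arrangements n
arrangements>2^ (suc (suc zero))    _ = s≤s (s≤s (s≤s (s≤s (s≤s z≤n))))
arrangements>2^ (suc (suc (suc n))) _ = s≤s (≤-trans (*-monoʳ-≤ 2 (<⇒≤ (arrangements>2^ (suc (suc n)) (s≤s (s≤s z≤n)))))
  (*-monoˡ-≤ (arrangements (suc (suc n))) {2} {suc (suc (suc n))} (s≤s (s≤s z≤n))))
arrangements>2^ (suc zero) (s≤s ())

funToFin-cong : ∀ {m n} {f g : Fin m → Fin n} → (∀ i → f i ≡ g i) → funToFin f ≡ funToFin g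
funToFin-cong {zero}  f≡g = refl
funToFin-cong {suc m} f≡g = cong₂ combine (f≡g zero) (funToFin-cong (f≡g ∘ suc))

n<2^n : ∀ n → n < 2 ^ n
n<2^n zero    = s≤s z≤n
n<2^n (suc n) = ≤-trans (+-mono-≤ (≤-trans (s≤s z≤n) (n<2^n n)) (n<2^n n)) (+-monoʳ-≤ (2 ^ n) (m≤m+n (2 ^ n) 0))

pigeonhole-ω : ∀ {n} (j : ℕ → Fin n) → Σ ℕ λ k → Σ ℕ λ l → k < l × j k ≡ j l
pigeonhole-ω {n} j with k , l , k<l , eq ← Fin.pigeonhole (ℕ.n<1+n n) (j ∘ toℕ) = toℕ k , toℕ l , k<l , eq

bit : Bool → ℕ
bit false = 0
bit true  = 1

bit-injective : ∀ {b c} → bit b ≡ bit c → b ≡ c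
bit-injective {false} {false} _ = refl
bit-injective {true}  {true}  _ = refl

-- Countable families of subsets and finite closures.

module Finiteness {a} (ext : Extensionality a a) (lem : PropExcludedMiddle a)
  (S : Set a) (g : (S → Bool) → List S) (f : List S → (S → Bool))
  (f-g : ∀ A → f (g A) ≡ A) (g-f : ∀ {t} → Unique t → g (f t) ≡ t)
  (g-unique : ∀ A → Unique (g A)) (s₀ : S) where

  open Classical ext lem

  g-injective : ∀ {A B} → g A ≡ g B → A ≡ B
  g-injective {A} {B} eq = trans (sym (f-g A)) (trans (cong f eq) (f-g B))

  open PowerInjection ext lem S g g-injective s₀ using (firstOutside; firstOutside-∉)

  _≟_ : DecidableEquality S
  x ≟ y = lem uip

  open DecMembership _≟_ using (_∈?_)

  extensionality : {A B : S → Bool} → (∀ s → A s ≡ B s) → A ≡ B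
  extensionality = lower-extensionality a a ext

  -- Choosing the least n in Escape makes firstOutside canonical, so that an
  -- unbounded family would yield an injection of ℕ into S.
  countable-bounded : (t : ℕ → List S) → ¬ ¬ (Σ (List S) λ l → ∀ i → All (_∈ l) (t i))
  countable-bounded t unbounded = DedekindInfinite.absurd ext lem S g g-injective e e-injective
    where
    Escape : List S → S → Set a
    Escape l s = Σ ℕ λ n → s ≡ firstOutside (_∈ l) (t n) × ¬ All (_∈ l) (t n) ×
                   (∀ {k} → k < n → ¬ ¬ All (_∈ l) (t k))
    Escape-unique : ∀ {l s s′} → Escape l s → Escape l s′ → s ≡ s′
    Escape-unique (m , refl , m∉ , <m) (n , refl , n∉ , <n) with ℕ.<-cmp m n
    ... | tri< m<n _ _ = contradiction m∉ (<n m<n)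
    ... | tri≈ _ refl _ = refl
    ... | tri> _ _ n<m = contradiction n∉ (<m n<m)
    least : ∀ l n → ¬ All (_∈ l) (t n) → ¬ ¬ (Σ S (Escape l))
    least l = <-rec _ λ n rec n∉ none → none (firstOutside (_∈ l) (t n) , n , refl , n∉ , λ k<n k∉ → rec k<n k∉ none)
    escape : ∀ l → Σ S λ s → ⟦ Escape l s ⟧ ≡ true
    escape l = prop-stable
      (Σ-irrelevant uip λ p q → ≡-stable (⟦⟧-elim p >>= λ p → ⟦⟧-elim q >>= λ q → return (Escape-unique p q)))
      λ none → unbounded (l , λ n → decidable-stable (All.all? (_∈? l) (t n))
        λ n∉ → least l n n∉ λ (s , esc) → none (s , ⟦⟧-intro esc))
    prefix : ℕ → List S
    prefix zero    = []
    prefix (suc n) = proj₁ (escape (prefix n)) ∷ prefix n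
    e : ℕ → S
    e n = proj₁ (escape (prefix n))
    e-∉ : ∀ n → ¬ e n ∈ prefix n
    e-∉ n e∈ = ⟦⟧-elim (proj₂ (escape (prefix n))) λ (k , eq , ∉ , _) →
      firstOutside-∉ (t k) (subst (_∈ prefix n) eq e∈) ∉
    e-∈ : ∀ {m n} → m < n → e m ∈ prefix n
    e-∈ {m} {suc n} (s≤s m≤n) with ℕ.m≤n⇒m<n∨m≡n m≤n
    ... | inj₁ m<n  = there (e-∈ m<n)
    ... | inj₂ refl = here refl
    e-injective : ∀ {m n} → e m ≡ e n → m ≡ n
    e-injective {m} {n} eq with ℕ.<-cmp m n
    ... | tri< m<n _ _ = contradiction (subst (_∈ prefix n) eq (e-∈ m<n)) (e-∉ n)
    ... | tri≈ _ m≡n _ = m≡n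
    ... | tri> _ _ n<m = contradiction (subst (_∈ prefix m) (sym eq) (e-∈ n<m)) (e-∉ m)

  infix 4 _⊑_

  _⊑_ : List S → (S → Bool) → Set a
  l ⊑ A = All (A ∋_) l

  ⊑-⊆ : ∀ {l A B} → A ⊆ B → l ⊑ A → l ⊑ B
  ⊑-⊆ A⊆B = All.map (A⊆B _)

  Finite : (S → Bool) → Set a
  Finite A = ¬ ¬ (Σ (List S) λ l → ∀ s → A ∋ s → s ∈ l)

  ⊆-finite : ∀ {A B} → A ⊆ B → Finite B → Finite A
  ⊆-finite A⊆B finB = finB >>= λ (l , B⊆l) → return (l , λ s → B⊆l s ∘ A⊆B s)

  elements : List S → (S → Bool)
  elements l s = ⟦ s ∈ l ⟧

  ∋-elements : ∀ l {s} → elements l ∋ s → s ∈ l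
  ∋-elements l {s} s∈ = decidable-stable (s ∈? l) (⟦⟧-elim s∈)

  record Enumerates {n : ℕ} (v : Fin n → S) (A : S → Bool) : Set a where
    field
      injective : ∀ {i j} → v i ≡ v j → i ≡ j
      sound     : ∀ i → A ∋ v i
      complete  : ∀ s → A ∋ s → Σ (Fin n) λ i → v i ≡ s

    position : ∀ {t} → t ⊑ A → Σ (List (Fin n)) λ p → map v p ≡ t
    position []       = [] , refl
    position (s∈ ∷ t⊑) = let i , eq = complete _ s∈ ; p , eqs = position t⊑ in i ∷ p , cong₂ _∷_ eq eqs

    rank : ∀ {t} → Unique t → t ⊑ A → Σ (Fin (arrangements n)) λ r → map v (unrank n r) ≡ t
    rank u t⊑ with p , refl ← position t⊑ with r , refl ← unrank-surjective n (Unique.map⁻ u) = r , refl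

    map-⊑ : ∀ p → map v p ⊑ A
    map-⊑ p = All.map⁺ (All.universal sound p)

    g-f-map : ∀ r → g (f (map v (unrank n r))) ≡ map v (unrank n r)
    g-f-map r = g-f (Unique.map⁺ injective (unrank-unique n r))

  list-enumerates : ∀ {A t} → Unique t → t ⊑ A → (∀ s → A ∋ s → s ∈ t) → Enumerates (lookup t) A
  list-enumerates {A} {t} u t⊑A A⊆t = record
    { injective = lookup-injective u
    ; sound = λ i → All.lookup t⊑A (∈-lookup i)
    ; complete = λ s s∈ → index (A⊆t s s∈) , sym (lookup-index (A⊆t s s∈))
    }

  enumerate : ∀ {A} → Finite A → ¬ ¬ (Σ (List S) λ t → Unique t × t ⊑ A × Enumerates (lookup t) A)
  enumerate {A} finA = finA >>= λ (l , A⊆l) →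
    let t = deduplicate _≟_ (filter A? l)
        u = UniqueDec.deduplicate-! _≟_ (filter A? l)
        t⊑A = All.tabulate λ s∈ → proj₂ (∈-filter⁻ A? {xs = l} (∈-deduplicate⁻ _≟_ (filter A? l) s∈))
    in return (t , u , t⊑A , list-enumerates u t⊑A
         λ s s∈A → ∈-deduplicate⁺ _≟_ (∈-filter⁺ A? (A⊆l s s∈A) s∈A))
    where
    A? : ∀ s → Dec (A ∋ s)
    A? s = A s Bool.≟ true

  finite-⋃ : ∀ n (A : Fin n → S → Bool) → (∀ i → Finite (A i)) →
             ¬ ¬ (Σ (List S) λ l → ∀ i s → A i ∋ s → s ∈ l)
  finite-⋃ zero    A fin = return ([] , λ ())
  finite-⋃ (suc n) A fin = do
    l , A⊆l ← fin zero
    m , A⊆m ← finite-⋃ n (A ∘ suc) (fin ∘ suc)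
    return (l ++ m , λ { zero s p → ∈-++⁺ˡ (A⊆l s p) ; (suc i) s p → ∈-++⁺ʳ l (A⊆m i s p) })

  representatives : ∀ n (A : Fin n → S → Bool) →
    ¬ ¬ (Σ (List S) λ l → ∀ i s → A i ∋ s → Σ S λ s′ → s′ ∈ l × A i ∋ s′)
  representatives zero    A = return ([] , λ ())
  representatives (suc n) A = do
    l , rep ← representatives n (A ∘ suc)
    decide (Σ S λ s → A zero ∋ s)
      (λ (s₁ , p₁) → return (s₁ ∷ l , λ
        { zero s p → s₁ , here refl , p₁
        ; (suc i) s p → let s′ , s′∈ , p′ = rep i s p in s′ , there s′∈ , p′ }))
      (λ none → return (l , λ { zero s p → contradiction (s , p) none ; (suc i) → rep i }))

  -- The fibres of κ form a countable family of subsets of S, so the lists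
  -- coding them share finitely many entries and hence are finite in number.
  finite-image : (κ : S → ℕ) → ¬ ¬ (Σ (List S) λ l → ∀ s → Σ S λ s′ → s′ ∈ l × κ s′ ≡ κ s)
  finite-image κ = do
    l , bounded ← countable-bounded (g ∘ fibre)
    t , _ , _ , enum ← enumerate {elements l} (return (l , λ s → ∋-elements l))
    let n = length t
        Y : Fin (arrangements n) → S → Bool
        Y r = f (map (lookup t) (unrank n r))
    m , rep ← representatives (arrangements n) Y
    return (m , λ s →
      let r , eq = Enumerates.rank enum (g-unique (fibre (κ s))) (All.map ⟦⟧-intro (bounded (κ s)))
          Y≡fibre : Y r ≡ fibre (κ s)
          Y≡fibre = trans (cong f eq) (f-g (fibre (κ s)))
          s′ , s′∈ , p = rep r s (subst (_∋ s) (sym Y≡fibre) (⟦⟧-intro (lift refl)))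
      in s′ , s′∈ , decidable-stable (κ s′ ℕ.≟ κ s)
           (⟦⟧-elim (subst (_∋ s′) Y≡fibre p) >>= (return ∘ lower)))
    where
    fibre : ℕ → S → Bool
    fibre i s = ⟦ Lift a (κ s ≡ i) ⟧

  module Closure {J : Set} (code : J → ℕ) (code-injective : ∀ {i j} → code i ≡ code j → i ≡ j)
    (K : List S → J → List S) (W : List S → (S → Bool)) (W-finite : ∀ t → Finite (W t)) where

    Added : List S → S → Set a
    Added t s = W t ∋ s ⊎ Σ J (λ j → s ∈ K t j)

    Q : (S → Bool) → (S → Bool)
    Q E s = ⟦ E ∋ s ⊎ Σ (List S) (λ t → Unique t × t ⊑ E × Added t s) ⟧

    Q-⊇ : ∀ E → E ⊆ Q E
    Q-⊇ E s p = ⟦⟧-intro (inj₁ p)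

    decoded : (t : List S) (i : ℕ) → Dec (Lift a (Σ J λ j → code j ≡ i)) → List S
    decoded t i (yes (lift (j , _))) = K t j
    decoded t i (no _)               = []

    -- Injectivity of `code` makes preimages unique, so having one is a decidable proposition. This
    -- turns families over `J` into families over `ℕ`.
    decode : (i : ℕ) → Dec (Lift a (Σ J λ j → code j ≡ i))
    decode i = lem λ { (lift (j , p)) (lift (k , q)) →
      cong lift (Σ-≡ uip (code-injective (trans p (sym q)))) }

    family : List S → ℕ → List S
    family t i = decoded t i (decode i)

    decoded-code : ∀ t j d → decoded t (code j) d ≡ K t j
    decoded-code t j (yes (lift (k , eq))) = cong (K t) (code-injective eq)
    decoded-code t j (no none)             = contradiction (lift (j , refl)) none

    Added-finite : ∀ t → Finite (λ s → ⟦ Added t s ⟧)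
    Added-finite t = do
      l , W⊆l ← W-finite t
      m , bounded ← countable-bounded (family t)
      return (l ++ m , λ s s∈ → decidable-stable (s ∈? l ++ m) (⟦⟧-elim s∈ >>= λ
        { (inj₁ p) → return (∈-++⁺ˡ (W⊆l s p))
        ; (inj₂ (j , p)) → return (∈-++⁺ʳ l (All.lookup (bounded (code j))
            (subst (s ∈_) (sym (decoded-code t j (decode (code j)))) p))) }))

    Q-finite : ∀ E → Finite E → Finite (Q E)
    Q-finite E finE = do
      t , _ , _ , enum ← enumerate finE
      let n = length t
      l , E⊆l ← finE
      m , added⊆m ← finite-⋃ (arrangements n) (λ r s → ⟦ Added (map (lookup t) (unrank n r)) s ⟧)
        (λ r → Added-finite _)
      return (l ++ m , λ s s∈ → decidable-stable (s ∈? l ++ m) (⟦⟧-elim s∈ >>= λ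
        { (inj₁ p) → return (∈-++⁺ˡ (E⊆l s p))
        ; (inj₂ (u , uniq , u⊑E , p)) → let r , eq = Enumerates.rank enum uniq u⊑E in
            return (∈-++⁺ʳ l (added⊆m r s (⟦⟧-intro (subst (λ u → Added u s) (sym eq) p)))) }))

    iterate : (S → Bool) → ℕ → (S → Bool)
    iterate E zero    = E
    iterate E (suc i) = Q (iterate E i)

    iterate-finite : ∀ {E} → Finite E → ∀ i → Finite (iterate E i)
    iterate-finite finE zero    = finE
    iterate-finite finE (suc i) = Q-finite _ (iterate-finite finE i)

    iterate-≤ : ∀ E {i j} → i ≤ j → iterate E i ⊆ iterate E j
    iterate-≤ E {i} i≤j = go (ℕ.≤⇒≤′ i≤j)
      where
      go : ∀ {j} → i ≤′ j → iterate E i ⊆ iterate E j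
      go ≤′-refl     = λ _ → id
      go (≤′-step p) = ⊆-trans (go p) (Q-⊇ _)

    -- The codes of the stages `iterate E₀ i` form a countable family, so their entries lie in one
    -- finite list and two stages coincide. As stages increase, the earlier of the two is stable
    -- under `Q`.
    closure : ∀ {E₀} → Finite E₀ → ¬ ¬ (Σ (S → Bool) λ E → Finite E × E₀ ⊆ E ×
      (∀ t → Unique t → t ⊑ E → W t ⊆ E × (∀ j → K t j ⊑ E)))
    closure {E₀} finE₀ = do
      l , bounded ← countable-bounded (g ∘ iterate E₀)
      t , _ , _ , enum ← enumerate {elements l} (return (l , λ s → ∋-elements l))
      let rank = λ i → Enumerates.rank enum (g-unique (iterate E₀ i)) (All.map ⟦⟧-intro (bounded i))
          i , j , i<j , eq = pigeonhole-ω (proj₁ ∘ rank)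
          E = iterate E₀ i
          Eᵢ≡Eⱼ : E ≡ iterate E₀ j
          Eᵢ≡Eⱼ = g-injective (trans (sym (proj₂ (rank i)))
            (trans (cong (map (lookup t) ∘ unrank (length t)) eq) (proj₂ (rank j))))
          Q⊆ : Q E ⊆ E
          Q⊆ = subst (Q E ⊆_) (sym Eᵢ≡Eⱼ) (iterate-≤ E₀ i<j)
      return (E , iterate-finite finE₀ i , iterate-≤ E₀ {0} {i} z≤n , λ t u t⊑E →
        (λ s p → Q⊆ s (⟦⟧-intro (inj₂ (_ , u , t⊑E , inj₁ p)))) ,
        (λ j → All.tabulate λ {s} p → Q⊆ s (⟦⟧-intro (inj₂ (_ , u , t⊑E , inj₂ (j , p))))))

-- Indistinguishability over a set, closed sets and their size.

module Supports {a} (ext : Extensionality a a) (lem : PropExcludedMiddle a)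
  (S : Set a) (g : (S → Bool) → List S) (f : List S → (S → Bool))
  (f-g : ∀ A → f (g A) ≡ A) (g-f : ∀ {t} → Unique t → g (f t) ≡ t)
  (g-unique : ∀ A → Unique (g A)) (s₀ : S) where

  open Classical ext lem
  open Finiteness ext lem S g f f-g g-f g-unique s₀
  open Enumerates

  eq : S → S → Bool
  eq s e = ⟦ s ≡ e ⟧

  eq-transfer : ∀ {s e s′ e′} → eq s e ≡ eq s′ e′ → s ≡ e → s′ ≡ e′
  eq-transfer p q = ≡-stable (⟦⟧-elim (trans (sym p) (⟦⟧-intro q)))

  Similar : (S → Bool) → S → S → Set a
  Similar E s s′ = (∀ A → g A ⊑ E → A s ≡ A s′) × (∀ e → E ∋ e → eq s e ≡ eq s′ e)

  Similar-antitone : ∀ {E F} → E ⊆ F → ∀ {s s′} → Similar F s s′ → Similar E s s′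
  Similar-antitone E⊆F (p , q) = (λ A A⊑E → p A (⊑-⊆ E⊆F A⊑E)) , (λ e e∈ → q e (E⊆F e e∈))

  -- This is the form that definability from `E` takes: being a union of indistinguishability
  -- classes.
  Invariant : (S → Bool) → (S → Bool) → Set a
  Invariant E A = ∀ s s′ → Similar E s s′ → A s ≡ A s′

  Closed : (S → Bool) → Set a
  Closed E = ∀ A → Invariant E A → g A ⊑ E

  span : List S → (S → Bool)
  span t s = ⟦ (∀ E → Closed E → t ⊑ E → E ∋ s) ⟧

  span-⊆ : ∀ {t E} → Closed E → t ⊑ E → span t ⊆ E
  span-⊆ cl t⊑E s s∈ = ∋-stable (⟦⟧-elim s∈ >>= λ all → return (all _ cl t⊑E))

  ⊑-span : ∀ t → t ⊑ span t
  ⊑-span t = All.tabulate λ s∈ → ⟦⟧-intro λ E cl t⊑E → All.lookup t⊑E s∈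

  -- `Similar` is antitone, so a set invariant over the span is invariant over every closed set
  -- containing `t`; its code lies in all of them.
  span-closed : ∀ t → Closed (span t)
  span-closed t A inv = All.tabulate λ s∈ → ⟦⟧-intro λ E cl t⊑E →
    All.lookup (cl A λ s s′ sim → inv s s′ (Similar-antitone (span-⊆ cl t⊑E) sim)) s∈

  profile : ∀ {n} → (Fin n → S) → S → Fin (arrangements n) → Bool
  profile {n} v s r = f (map v (unrank n r)) s

  -- When `v` enumerates `E`, this number names the class of `s` over `E`. Being relative to `v`, it
  -- also allows points to be compared through two different enumerations.
  κ : ∀ {n} → (Fin n → S) → S → ℕ
  κ v s = listCode (listCode (tabulate (bit ∘ profile v s)) ∷ listCode (tabulate (bit ∘ eq s ∘ v)) ∷ [])

  module _ {n} {v w : Fin n → S} {s s′ : S} where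

    κ-profile : κ v s ≡ κ w s′ → ∀ r → profile v s r ≡ profile w s′ r
    κ-profile p r = bit-injective {profile v s r} {profile w s′ r} (tabulate-injective (listCode-injective
      (proj₁ (∷-injective (listCode-injective p)))) r)

    κ-eq : κ v s ≡ κ w s′ → ∀ i → eq s (v i) ≡ eq s′ (w i)
    κ-eq p i = bit-injective {eq s (v i)} {eq s′ (w i)} (tabulate-injective (listCode-injective
      (proj₁ (∷-injective (proj₂ (∷-injective (listCode-injective p)))))) i)

  module _ {n} {v : Fin n → S} {E : S → Bool} (enum : Enumerates v E) where

    f-rank : ∀ {A} → g A ⊑ E → Σ (Fin (arrangements n)) λ r → f (map v (unrank n r)) ≡ A
    f-rank {A} A⊑E = let r , p = rank enum (g-unique A) A⊑E in r , trans (cong f p) (f-g A)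

    f-map-⊑ : ∀ r → g (f (map v (unrank n r))) ⊑ E
    f-map-⊑ r = subst (_⊑ E) (sym (g-f-map enum r)) (map-⊑ enum (unrank n r))

    κ⇒Similar : ∀ {s s′} → κ v s ≡ κ v s′ → Similar E s s′
    κ⇒Similar p =
      (λ A A⊑E → let r , q = f-rank A⊑E in
        trans (cong (λ B → B _) (sym q)) (trans (κ-profile {v = v} {v} p r) (cong (λ B → B _) q))) ,
      (λ e e∈ → let i , q = complete enum e e∈ in
        subst (λ e → eq _ e ≡ eq _ e) q (κ-eq {v = v} {v} p i))

    Similar⇒κ : ∀ {s s′} → Similar E s s′ → κ v s ≡ κ v s′
    Similar⇒κ (p , q) = cong₂ (λ l m → listCode (listCode l ∷ listCode m ∷ []))
      (tabulate-cong λ r → cong bit (p _ (f-map-⊑ r)))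
      (tabulate-cong λ i → cong bit (q (v i) (sound enum i)))

    -- By `finite-image` only finitely many classes occur, so each invariant set is given by a list
    -- `D` of class numbers. Closedness thus amounts to countably many conditions, within reach of
    -- `Closure`.
    closed-by-κ : (∀ D → g (λ s → ⟦ Lift a (κ v s ∈ D) ⟧) ⊑ E) → Closed E
    closed-by-κ closed A inv = All-∋-stable E (g A) do
      l , rep ← finite-image (κ v)
      let A? = λ s → A s Bool.≟ true
          D = map (κ v) (filter A? l)
          D≡A : (λ s → ⟦ Lift a (κ v s ∈ D) ⟧) ≡ A
          D≡A = ⊆-antisym
            (λ s s∈ → ∋-stable (⟦⟧-elim s∈ >>= λ (lift k∈) → return
              (let s′ , s′∈ , p = ∈-map⁻ (κ v) k∈ in
               trans (inv s s′ (κ⇒Similar p)) (proj₂ (∈-filter⁻ A? {xs = l} s′∈)))))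
            (λ s s∈ → ⟦⟧-intro (lift (let s′ , s′∈ , p = rep s in
              subst (_∈ D) p (∈-map⁺ (κ v) (∈-filter⁺ A? s′∈ (trans (inv s′ s (κ⇒Similar p)) s∈))))))
      return (subst (λ B → g B ⊑ E) D≡A (closed D))

    record Classes : Set a where
      field
        count       : ℕ
        class       : S → Fin count
        member      : Fin count → S
        class-member : ∀ i → class (member i) ≡ i
        similar     : ∀ {s s′} → class s ≡ class s′ → Similar E s s′
        power       : arrangements n ≡ 2 ^ count

    -- Sequences over `E` correspond to unions of classes: `f` sends the former injectively to the
    -- latter, and closedness puts the code of each union over `E`. Counting both sides gives
    -- `power`.
    classes : Closed E → ¬ ¬ Classes
    classes closed = do
      l , rep ← finite-image (κ v)
      return (build l rep)
      where
      module _ (l : List S) (rep : ∀ s → Σ S λ s′ → s′ ∈ l × κ v s′ ≡ κ v s) where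
        D : List ℕ
        D = deduplicate ℕ._≟_ (map (κ v) l)
        k : ℕ
        k = length D
        κ∈D : ∀ s → κ v s ∈ D
        κ∈D s = let s′ , s′∈ , p = rep s in ∈-deduplicate⁺ ℕ._≟_ (subst (_∈ map (κ v) l) p (∈-map⁺ (κ v) s′∈))
        ρ : S → Fin k
        ρ s = index (κ∈D s)
        lookup-ρ : ∀ s → κ v s ≡ lookup D (ρ s)
        lookup-ρ s = lookup-index (κ∈D s)
        pick : ∀ i → Σ S λ s → lookup D i ≡ κ v s
        pick i = let s , _ , p = ∈-map⁻ (κ v) (∈-deduplicate⁻ ℕ._≟_ (map (κ v) l) (∈-lookup i)) in s , p
        σ : Fin k → S
        σ = proj₁ ∘ pick
        lookup-D-injective : ∀ {i j} → lookup D i ≡ lookup D j → i ≡ j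
        lookup-D-injective = lookup-injective (UniqueDec.deduplicate-! ℕ._≟_ (map (κ v) l))
        ρ-σ : ∀ i → ρ (σ i) ≡ i
        ρ-σ i = lookup-D-injective (trans (sym (lookup-ρ (σ i))) (sym (proj₂ (pick i))))
        ρ-similar : ∀ {s s′} → ρ s ≡ ρ s′ → Similar E s s′
        ρ-similar p = κ⇒Similar (trans (lookup-ρ _) (trans (cong (lookup D) p) (sym (lookup-ρ _))))
        similar-ρ : ∀ {s s′} → Similar E s s′ → ρ s ≡ ρ s′
        similar-ρ sim = lookup-D-injective (trans (sym (lookup-ρ _)) (trans (Similar⇒κ sim) (lookup-ρ _)))
        toBool : Fin 2 → Bool
        toBool zero    = false
        toBool (suc _) = true
        toFin : Bool → Fin 2
        toFin false = zero
        toFin true  = suc zero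
        toBool-injective : ∀ {i j} → toBool i ≡ toBool j → i ≡ j
        toBool-injective {zero}     {zero}     _ = refl
        toBool-injective {suc zero} {suc zero} _ = refl
        toFin-injective : ∀ {b c} → toFin b ≡ toFin c → b ≡ c
        toFin-injective {false} {false} _ = refl
        toFin-injective {true}  {true}  _ = refl
        set : Fin (2 ^ k) → S → Bool
        set x s = toBool (finToFun {2} {k} x (ρ s))
        encode : (x : Fin (2 ^ k)) → Σ (Fin (arrangements n)) λ r → f (map v (unrank n r)) ≡ set x
        encode x = f-rank (closed (set x) λ s s′ sim → cong (toBool ∘ finToFun x) (similar-ρ sim))
        encode-injective : ∀ {x y} → proj₁ (encode x) ≡ proj₁ (encode y) → x ≡ y
        encode-injective {x} {y} p = trans (sym (Fin.funToFin-finToFin {k} x))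
          (trans (funToFin-cong λ i → toBool-injective (subst (λ j → toBool (finToFun x j) ≡ toBool (finToFun y j))
            (ρ-σ i) (cong (λ B → B (σ i)) set≡))) (Fin.funToFin-finToFin {k} y))
          where
          set≡ : set x ≡ set y
          set≡ = trans (sym (proj₂ (encode x))) (trans (cong (f ∘ map v ∘ unrank n) p) (proj₂ (encode y)))
        decode : Fin (arrangements n) → Fin (2 ^ k)
        decode r = funToFin (λ i → toFin (profile v (σ i) r))
        decode-injective : ∀ {r r′} → decode r ≡ decode r′ → r ≡ r′
        decode-injective {r} {r′} p = unrank-injective n (map-injective (injective enum)
          (trans (sym (g-f-map enum r)) (trans (cong g (extensionality same)) (g-f-map enum r′))))
          where
          at : ∀ i → profile v (σ i) r ≡ profile v (σ i) r′
          at i = toFin-injective (trans (sym (Fin.finToFun-funToFin _ i))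
            (trans (cong (λ x → finToFun x i) p) (Fin.finToFun-funToFin _ i)))
          σρ : ∀ s r → profile v s r ≡ profile v (σ (ρ s)) r
          σρ s r = proj₁ (ρ-similar (sym (ρ-σ (ρ s)))) _ (f-map-⊑ r)
          same : ∀ s → profile v s r ≡ profile v s r′
          same s = trans (σρ s r) (trans (at (ρ s)) (sym (σρ s r′)))
        build : Classes
        build = record
          { count = k ; class = ρ ; member = σ ; class-member = ρ-σ ; similar = ρ-similar
          ; power = ℕ.≤-antisym (Fin.injective⇒≤ decode-injective) (Fin.injective⇒≤ encode-injective) }

-- Types over a finite closed set and the automorphism argument.

module Main {a} (ext : Extensionality a a) (lem : PropExcludedMiddle a)
  (S : Set a) (g : (S → Bool) → List S) (f : List S → (S → Bool))
  (f-g : ∀ A → f (g A) ≡ A) (g-f : ∀ {t} → Unique t → g (f t) ≡ t)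
  (g-unique : ∀ A → Unique (g A)) (s₀ : S) where

  open Classical ext lem
  open Finiteness ext lem S g f f-g g-f g-unique s₀
  open Supports ext lem S g f f-g g-f g-unique s₀
  open Enumerates
  open DecMembership _≟_ using (_∈?_)

  Index : Set
  Index = ℕ × List ℕ × List ℕ

  indexCode : Index → ℕ
  indexCode (m , q , D) = listCode (m ∷ listCode q ∷ listCode D ∷ [])

  indexCode-injective : ∀ {i j} → indexCode i ≡ indexCode j → i ≡ j
  indexCode-injective p with refl , p ← ∷-injective (listCode-injective p)
    with q , p ← ∷-injective p with r , _ ← ∷-injective p =
    cong₂ (λ q D → _ , q , D) (listCode-injective q) (listCode-injective r)

  saturate : List S → List ℕ → (S → Bool)
  saturate t D s = ⟦ Lift a (κ (lookup t) s ∈ D) ⟧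

  -- A finite set containing `t` and the codes of all its sets `saturate` is closed, and so bounds
  -- the span.
  span-finite : ∀ t → Finite (span t)
  span-finite t = do
    E , finE , t⊆E , closedE ← closure {elements t} (return (t , λ s → ∋-elements t))
    u , uniq , u⊑E , enum ← enumerate finE
    ⊆-finite (span-⊆ (closed-by-κ enum λ D → proj₂ (closedE u uniq u⊑E) D)
      (All.tabulate λ s∈ → t⊆E _ (⟦⟧-intro s∈))) finE
    where
    open Closure listCode listCode-injective (λ t D → g (saturate t D)) (λ _ _ → false)
      (λ _ → return ([] , λ _ ()))

  Image : ∀ {m} → (Fin m → S) → List ℕ → Set a
  Image v D = (∀ s → κ v s ∈ D) × (∀ k → k ∈ D → ¬ ¬ (Σ S λ s → κ v s ≡ k))

  -- The isomorphism type of the closure of `x ∷ t`: its size `m`, the positions `q` of `x ∷ t` in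
  -- an enumeration, and the class numbers `D` that occur. All of this is countable data.
  HasType : List S → Index → S → Set a
  HasType t (m , q , D) x = Σ (Fin m → S) λ v → Σ (List (Fin m)) λ p → map toℕ p ≡ q ×
    map v p ≡ x ∷ t × Enumerates v (span (x ∷ t)) × Image v D

  realize : List S → Index → (S → Bool)
  realize t i x = ⟦ HasType t i x ⟧

  typed : ∀ t x → ¬ ¬ (Σ Index λ i → HasType t i x)
  typed t x = do
    u , _ , _ , enum ← enumerate (span-finite (x ∷ t))
    l , rep ← finite-image (κ (lookup u))
    let p , eq = position enum (⊑-span (x ∷ t))
        k = κ (lookup u)
    return ((length u , map toℕ p , map k l) , lookup u , p , refl , eq , enum ,
      (λ s → let s′ , s′∈ , eq = rep s in subst (_∈ map k l) eq (∈-map⁺ k s′∈)) ,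
      (λ _ k∈ → let s , _ , eq = ∈-map⁻ k k∈ in return (s , sym eq)))

  module Automorphism {m} {v w : Fin m → S} {V : S → Bool} (closedV : Closed V)
    (enum-v : Enumerates v V) (enum-w : Enumerates w V)
    {D : List ℕ} (image-v : Image v D) (image-w : Image w D) where

    -- R relates v i to w i only, and extends this correspondence to all of S.
    R : S → S → Set
    R s s′ = κ v s ≡ κ w s′

    back : ∀ s′ → ¬ ¬ (Σ S λ s → R s s′)
    back s′ = proj₂ image-v _ (proj₁ image-w s′)

    R-v : ∀ {i s′} → R (v i) s′ → s′ ≡ w i
    R-v {i} p = eq-transfer (κ-eq {v = v} {w} p i) refl

    R-w : ∀ {i s} → R s (w i) → s ≡ v i
    R-w {i} p = eq-transfer (sym (κ-eq {v = v} {w} p i)) refl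

    fixed : S → Bool
    fixed s = ⟦ Σ (Fin m) (λ i → v i ≡ s × w i ≡ s) ⟧

    fixed-⊆ : fixed ⊆ V
    fixed-⊆ s s∈ = ∋-stable (⟦⟧-elim s∈ >>= λ { (i , refl , _) → return (sound enum-v i) })

    fixed-v : ∀ i → fixed ∋ v i → w i ≡ v i
    fixed-v i i∈ = ≡-stable (⟦⟧-elim i∈ >>= λ (j , vj≡vi , wj≡vi) →
      return (subst (λ k → w k ≡ v i) (injective enum-v vj≡vi) wj≡vi))

    fixed-map : ∀ {t} p → map v p ≡ t → map w p ≡ t → t ⊑ fixed
    fixed-map []      refl _  = []
    fixed-map (i ∷ p) refl eq =
      ⟦⟧-intro (i , refl , proj₁ (∷-injective eq)) ∷ fixed-map p refl (proj₂ (∷-injective eq))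

    map-fixed : ∀ p → map v p ⊑ fixed → map w p ≡ map v p
    map-fixed []      []       = refl
    map-fixed (i ∷ p) (i∈ ∷ p⊑) = cong₂ _∷_ (fixed-v i i∈) (map-fixed p p⊑)

    -- Write `g A` as `map v u`. By invariance under `R`, the set with code `map w u` is again `A`,
    -- so the two lists agree and every entry is fixed.
    g-fixed : ∀ A → (∀ s s′ → R s s′ → A s ≡ A s′) → g A ⊑ V → g A ⊑ fixed
    g-fixed A invariant A⊑V =
      let r , eq = rank enum-v (g-unique A) A⊑V
          u = unrank m r
          moved : f (map w u) ≡ A
          moved = extensionality λ s′ → decidable-stable (_ Bool.≟ _) (back s′ >>= λ (s , Rss′) →
            return (trans (sym (κ-profile {v = v} {w} Rss′ r))
              (trans (cong (λ B → B s) (trans (cong f eq) (f-g A))) (invariant s s′ Rss′))))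
      in fixed-map u eq (trans (sym (g-f-map enum-w r)) (cong g moved))

    -- A list of fixed points has the same positions in `v` and in `w`, so equal `κ` gives agreement
    -- on the set it codes.
    R⇒Similar : ∀ s s′ → R s s′ → Similar fixed s s′
    R⇒Similar s s′ Rss′ =
      (λ A A⊑ →
        let r , eq = rank enum-v (g-unique A) (⊑-⊆ fixed-⊆ A⊑)
            eq′ = trans (map-fixed (unrank m r) (subst (_⊑ fixed) (sym eq) A⊑)) eq
            at : ∀ {t} → t ≡ g A → ∀ s → f t s ≡ A s
            at p s = cong (λ B → B s) (trans (cong f p) (f-g A))
        in trans (sym (at eq s)) (trans (κ-profile {v = v} {w} Rss′ r) (at eq′ s′))) ,
      (λ e e∈ → decidable-stable (_ Bool.≟ _) (⟦⟧-elim e∈ >>= λ { (i , refl , wi≡vi) →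
        return (subst (λ e → eq s (v i) ≡ eq s′ e) wi≡vi (κ-eq {v = v} {w} Rss′ i)) }))

    fixed-closed : Closed fixed
    fixed-closed A inv = g-fixed A (λ s s′ Rss′ → inv s s′ (R⇒Similar s s′ Rss′))
      (closedV A λ s s′ sim → inv s s′ (Similar-antitone fixed-⊆ sim))

    g-V-fixed : g V ⊑ fixed
    g-V-fixed = g-fixed V R-V (closedV V λ s s′ (_ , q) → ∋-iff
        (λ s∈ → subst (V ∋_) (sym (eq-transfer (q s s∈) refl)) s∈)
        (λ s′∈ → subst (V ∋_) (sym (eq-transfer (sym (q s′ s′∈)) refl)) s′∈))
      where
      R-V : ∀ s s′ → R s s′ → V s ≡ V s′
      R-V s s′ Rss′ = ∋-iff
        (λ s∈ → let i , eq = complete enum-v s s∈ in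
          subst (V ∋_) (sym (R-v (subst (λ s → R s s′) (sym eq) Rss′))) (sound enum-w i))
        (λ s′∈ → let i , eq = complete enum-w s′ s′∈ in
          subst (V ∋_) (sym (R-w (subst (R s) (sym eq) Rss′))) (sound enum-v i))

  coded : List S → (S → Bool)
  coded t s = ⟦ Σ (S → Bool) (λ A → g A ≡ t × Finite A × A ∋ s) ⟧

  -- Injectivity of `g` leaves at most one finite set with code `t`.
  coded-finite : ∀ t → Finite (coded t)
  coded-finite t = decide (Σ (S → Bool) λ A → g A ≡ t × Finite A)
    (λ (A , gA≡t , finA) → ⊆-finite (λ s s∈ → ∋-stable (⟦⟧-elim s∈ >>= λ (B , gB≡t , _ , Bs) →
      return (subst (_∋ s) (g-injective (trans gB≡t (sym gA≡t))) Bs))) finA)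
    (λ none → return ([] , λ s s∈ → ⊥-elim (⟦⟧-elim s∈ λ (A , gA≡t , finA , _) → none (A , gA≡t , finA))))

  family : List S → Index → List S
  family t i@(_ , _ , D) = g (saturate t D) ++ g (realize t i)

  module _ (E : S → Bool) (t : List S) (t-unique : Unique t) (t⊑E : t ⊑ E)
    (enum : Enumerates (lookup t) E)
    (saturates : ∀ D → g (saturate t D) ⊑ E) (realizes : ∀ i → g (realize t i) ⊑ E)
    (codes : ∀ A → g A ⊑ E → Finite A → A ⊆ E) where

    closedE : Closed E
    closedE = closed-by-κ enum saturates

    -- If `E` were everything, distinct classes would have distinct members listed in `t`, so
    -- `arrangements` of its length would be at most two to that length. This fails from length two
    -- on.
    E-proper : ∀ {x y} → x ≢ y → ¬ (∀ s → E ∋ s)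
    E-proper {x} {y} x≢y all = classes enum closedE λ cls →
      let open Classes cls
          pos = λ s → complete enum s (all s)
          pos-injective : ∀ {s s′} → proj₁ (pos s) ≡ proj₁ (pos s′) → s ≡ s′
          pos-injective {s} {s′} p = trans (sym (proj₂ (pos s))) (trans (cong (lookup t) p) (proj₂ (pos s′)))
          two : Fin 2 → Fin (length t)
          two = λ { zero → proj₁ (pos x) ; (suc _) → proj₁ (pos y) }
          two-injective : ∀ {i j} → two i ≡ two j → i ≡ j
          two-injective = λ
            { {zero} {zero} _ → refl ; {zero} {suc zero} p → contradiction (pos-injective p) x≢y
            ; {suc zero} {zero} p → contradiction (sym (pos-injective p)) x≢y
            ; {suc zero} {suc zero} _ → refl }
          count≤ : count ≤ length t
          count≤ = Fin.injective⇒≤ {f = proj₁ ∘ pos ∘ member} λ {i} {j} p →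
            trans (sym (class-member i)) (trans (cong class (pos-injective p)) (class-member j))
      in ℕ.<⇒≱ (arrangements>2^ (length t) (Fin.injective⇒≤ two-injective))
           (subst (_≤ 2 ^ length t) (sym power) (ℕ.^-monoʳ-≤ 2 count≤))

    Minimal : S → Set a
    Minimal x = ∀ u → span (x ∷ t) ∋ u → ¬ E ∋ u → span (u ∷ t) ∋ x

    span-mono : ∀ {u x} → span (x ∷ t) ∋ u → span (u ∷ t) ⊆ span (x ∷ t)
    span-mono {u} {x} u∈ = span-⊆ (span-closed (x ∷ t)) (u∈ ∷ All.tail (⊑-span (x ∷ t)))

    -- If `x` is not minimal, some `u` outside `E` has a smaller span that omits `x`. Removing `x`
    -- from the covering list makes the descent terminate.
    minimal : ∀ n l → length l ≤ n → ∀ x → ¬ E ∋ x → (∀ s → span (x ∷ t) ∋ s → s ∈ l) →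
              ¬ ¬ (Σ S λ x → ¬ E ∋ x × Minimal x)
    minimal n l l≤n x x∉ cover with cover x (All.head (⊑-span (x ∷ t)))
    minimal zero    []      _   x x∉ cover | ()
    minimal (suc n) l@(_ ∷ _) l≤n x x∉ cover | x∈l =
      decide (Σ S λ u → span (x ∷ t) ∋ u × ¬ E ∋ u × ¬ span (u ∷ t) ∋ x)
        (λ (u , u∈ , u∉ , x∉u) → minimal n (filter (λ s → ¬? (s ≟ x)) l)
          (ℕ.≤-pred (ℕ.≤-trans (filter-notAll (λ s → ¬? (s ≟ x)) l (Any.map (λ p ¬p → ¬p (sym p)) x∈l)) l≤n))
          u u∉ λ s s∈ → ∈-filter⁺ (λ s → ¬? (s ≟ x)) (cover s (span-mono u∈ s s∈))
            λ { refl → x∉u s∈ })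
        (λ none → return (x , x∉ , λ u u∈ u∉ → ∋-stable λ x∉u → none (u , u∈ , u∉ , x∉u)))

    module _ {x} (x∉ : ¬ E ∋ x) (min : Minimal x) where

      V : S → Bool
      V = span (x ∷ t)

      closedV : Closed V
      closedV = span-closed (x ∷ t)

      E⊆V : E ⊆ V
      E⊆V s s∈ = let i , eq = complete enum s s∈ in
        subst (V ∋_) eq (All.lookup (All.tail (⊑-span (x ∷ t))) (∈-lookup i))

      span≡V : ∀ {u} → V ∋ u → ¬ E ∋ u → span (u ∷ t) ≡ V
      span≡V u∈ u∉ = ⊆-antisym (span-mono u∈) (span-mono (min _ u∈ u∉))

      -- The sets `realize t i` have codes over `E`, so `y` and `z` share a type. The resulting
      -- automorphism of `V` fixes `t` and moves `y`; its fixed points lie in `E`, so the code of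
      -- `V` does too, and `codes` puts `y` in `E`.
      indistinguishable-absurd : ∀ {y z} → V ∋ y → ¬ E ∋ y → V ∋ z → ¬ E ∋ z → y ≢ z → Similar E y z → ⊥
      indistinguishable-absurd {y} {z} y∈ y∉ z∈ z∉ y≢z (sim , _) = typed t y λ (i , ty) →
        ⟦⟧-elim (trans (sym (sim (realize t i) (realizes i))) (⟦⟧-intro ty)) λ tz → go i ty tz
        where
        go : ∀ i → HasType t i y → HasType t i z → ⊥
        go (m , _ , D) (v , p , refl , vp , enum-v , image-v) (w , p′ , p′≡p , wp , enum-w , image-w)
          -- Equal position lists place `y` in `v` where `z` is in `w`, and each entry of `t` at one
          -- index in both.
          with refl ← map-injective Fin.toℕ-injective p′≡p = ends p vp wp
          where
          enum-v′ = subst (Enumerates v) (span≡V y∈ y∉) enum-v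
          enum-w′ = subst (Enumerates w) (span≡V z∈ z∉) enum-w
          open Automorphism closedV enum-v′ enum-w′ image-v image-w
          ends : ∀ p → map v p ≡ y ∷ t → map w p ≡ z ∷ t → ⊥
          ends (i ∷ p) vp wp = y∉ (codes V (⊑-⊆ fixed⊆E g-V-fixed) (span-finite (x ∷ t)) y y∈)
            where
            t⊑fixed : t ⊑ fixed
            t⊑fixed = fixed-map p (proj₂ (∷-injective vp)) (proj₂ (∷-injective wp))
            vi≡y = proj₁ (∷-injective vp)
            y∉fixed : ¬ fixed ∋ y
            y∉fixed y∈f = y≢z (trans (sym vi≡y) (trans (sym (fixed-v i (subst (fixed ∋_) (sym vi≡y) y∈f)))
              (proj₁ (∷-injective wp))))
            -- By minimality, a fixed `u` outside `E` would generate `V` over `t`, making `y` fixed.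
            fixed⊆E : fixed ⊆ E
            fixed⊆E u u∈ = ∋-stable λ u∉ → y∉fixed (span-⊆ fixed-closed (u∈ ∷ t⊑fixed) y
              (subst (_∋ y) (sym (span≡V (fixed-⊆ u u∈) u∉)) y∈))

      -- The lists `t` and `t ++ δ` enumerate closed sets, so both numbers of arrangements are
      -- powers of two and `count < 2 ^ count ≤ d`. Two of the `d` points outside `E` then share a
      -- class.
      no-minimal : ⊥
      no-minimal = (do
        δ , δ-unique , δ⊑ , enumδ ← enumerate {V∖E} (⊆-finite V∖E⊆V (span-finite (x ∷ t)))
        clsE ← classes enum closedE
        clsV ← classes (enum-++ δ-unique δ⊑ enumδ) closedV
        let open Classes clsE
            d = length δ
            k<d : count < d
            k<d = ℕ.<-≤-trans (n<2^n count) (arrangements-gap (length t) d count (Classes.count clsV)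
              (0<Fin (proj₁ (complete enumδ x (⟦⟧-intro (lift (All.head (⊑-span (x ∷ t)) , x∉))))))
              (0<Fin (class x)) power
              (subst (λ n → arrangements n ≡ 2 ^ Classes.count clsV) (length-++ t) (Classes.power clsV)))
            i , j , i<j , same = Fin.pigeonhole k<d (class ∘ lookup δ)
            V∖E-lookup = λ i → V∖E-elim (sound enumδ i)
        return (indistinguishable-absurd (proj₁ (V∖E-lookup i)) (proj₂ (V∖E-lookup i)) (proj₁ (V∖E-lookup j)) (proj₂ (V∖E-lookup j))
          (λ eq → Fin.<⇒≢ i<j (injective enumδ eq)) (similar same))) id
        where
        V∖E : S → Bool
        V∖E s = ⟦ Lift a (V ∋ s × ¬ E ∋ s) ⟧
        V∖E-elim : ∀ {s} → V∖E ∋ s → V ∋ s × ¬ E ∋ s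
        V∖E-elim s∈ = ∋-stable (⟦⟧-elim s∈ >>= (return ∘ proj₁ ∘ lower)) ,
          λ s∈E → ⟦⟧-elim s∈ λ (lift (_ , s∉E)) → s∉E s∈E
        V∖E⊆V : V∖E ⊆ V
        V∖E⊆V s = proj₁ ∘ V∖E-elim
        0<Fin : ∀ {n} → Fin n → 0 < n
        0<Fin zero    = s≤s z≤n
        0<Fin (suc _) = s≤s z≤n
        enum-++ : ∀ {δ} → Unique δ → δ ⊑ V∖E → Enumerates (lookup δ) V∖E → Enumerates (lookup (t ++ δ)) V
        enum-++ {δ} δ-unique δ⊑ enumδ = list-enumerates
          (Unique.++⁺ t-unique δ-unique λ (p , q) → proj₂ (V∖E-elim (All.lookup δ⊑ q)) (All.lookup t⊑E p))
          (All.++⁺ (⊑-⊆ E⊆V t⊑E) (⊑-⊆ V∖E⊆V δ⊑))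
          λ s s∈ → decidable-stable (s ∈? t ++ δ) (decide (Lift a (E ∋ s))
            (λ (lift s∈E) → return (∈-++⁺ˡ (listed t enum s∈E)))
            (λ s∉E → return (∈-++⁺ʳ t (listed δ enumδ (⟦⟧-intro (lift (s∈ , s∉E ∘ lift)))))))
          where
          listed : ∀ {A} u {s} → Enumerates (lookup u) A → A ∋ s → s ∈ u
          listed u enum s∈ = let i , eq = complete enum _ s∈ in subst (_∈ u) eq (∈-lookup i)

    support-absurd : ∀ {x y} → x ≢ y → ⊥
    support-absurd x≢y = (decide (Σ S λ s → ¬ E ∋ s)
      (λ (x , x∉) → span-finite (x ∷ t) >>= λ (l , cover) →
        minimal (length l) l ℕ.≤-refl x x∉ cover >>= λ (x , x∉ , min) →
        return (no-minimal x∉ min))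
      (λ none → return (E-proper x≢y λ s → ∋-stable λ s∉ → none (s , s∉)))) id

  absurd : ∀ {x y : S} → x ≢ y → ⊥
  absurd x≢y = (do
    -- Starting from the empty set, one closure secures the saturated sets, the realized types and
    -- the finite coded sets together.
    E , finE , _ , closedE ← closure {λ _ → false} (return ([] , λ _ ()))
    t , t-unique , t⊑E , enum ← enumerate finE
    let K⊑E = λ i → proj₂ (closedE t t-unique t⊑E) i
    return (support-absurd E t t-unique t⊑E enum
      (λ D → All.++⁻ˡ (g (saturate t D)) (K⊑E (0 , [] , D)))
      (λ i → All.++⁻ʳ (g (saturate t (proj₂ (proj₂ i)))) (K⊑E i))
      (λ A A⊑E finA s s∈ → proj₁ (closedE (g A) (g-unique A) A⊑E) s (⟦⟧-intro (A , refl , finA , s∈)))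
      x≢y)) id
    where
    open Closure indexCode indexCode-injective family coded coded-finite

-- From a bijection of setoids to maps on lists and Boolean subsets.

theorem4 : ∀ {a} → Extensionality a a → PropExcludedMiddle a →
    (S : Set a) → (∃₂ λ (x y : S) → x ≢ y) →
    ¬ Bijection (Seq S) (𝒫 S)
theorem4 {a} ext lem S (x , y , x≢y) F = Main.absurd ext lem S g f f-g g-f g-unique x x≢y
  where
  open Bijection F using (to; injective; surjective)
  open Classical ext lem

  _≟_ : DecidableEquality S
  x ≟ y = lem uip

  f′ : (t : List S) → Dec (Unique t) → (S → Bool)
  f′ t (yes u) s = ⟦ proj₁ (to (t , u)) s ⟧
  -- The map is to be total on lists; those with a repetition receive the empty set.
  f′ t (no _)  s = false

  f : List S → (S → Bool)
  f t = f′ t (unique? _≟_ t)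

  sequence : ∀ A → _
  sequence A = surjective ((λ s → Lift a (A ∋ s)) , λ { (lift p) (lift q) → cong lift (uip p q) })

  g : (S → Bool) → List S
  g A = proj₁ (proj₁ (sequence A))

  g-unique : ∀ A → Unique (g A)
  g-unique A = proj₂ (proj₁ (sequence A))

  f-g : ∀ A → f (g A) ≡ A
  f-g A = lemma (unique? _≟_ (g A))
    where
    lemma : ∀ d → f′ (g A) d ≡ A
    lemma (no ¬u) = contradiction (g-unique A) ¬u
    lemma (yes u) = ⊆-antisym
      (λ s s∈ → ∋-stable (⟦⟧-elim s∈ >>= λ p → return (lower (proj₁ same p))))
      (λ s s∈ → ⟦⟧-intro (proj₂ same (lift s∈)))
      where same = proj₂ (sequence A) {g A , u} refl

  g-f : ∀ {t} → Unique t → g (f t) ≡ t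
  g-f {t} = lemma (unique? _≟_ t)
    where
    lemma : ∀ d → Unique t → g (f′ t d) ≡ t
    lemma (no ¬u) u = contradiction u ¬u
    -- Subsets are proposition-valued, so `prop-stable` undoes the double negation introduced by
    -- `⟦_⟧`.
    lemma (yes u) _ = injective {proj₁ preimage} {t , u}
      ( (λ p → prop-stable (proj₂ (to (t , u))) (⟦⟧-elim (lower (proj₁ same p))))
      , (λ p → proj₂ same (lift (⟦⟧-intro p))))
      where
      preimage = sequence (f′ t (yes u))
      same = proj₂ preimage {proj₁ preimage} refl
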